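{- Let $d \geq 2$, $n$ and $N$ be three positive integers that satisfy $$n\ge 2^{60d}\quad\text{and}\quad N\ge (2^{13} n)^d.$$ Then any depth-$d$ monotone majority circuit that computes $U_{d,N}$ must have size at least $2^{n/2^{60d}}$.
   Context: For a positive integer $t$, $[t]=\{1,\dots,t\}$. For $k\ge 2$ and $N\ge 1$, the Boolean function $U_{k,N}:\{0,1\}^{k\times N}\to\{0,1\}$ is defined as follows: for $x=(x_{i,j})_{i\in[k],j\in[N]}$, put $\mathsf{SUM}(x)=\sum_{j=1}^{N}2^{N-j}(x_{1,j}+\cdots+x_{k,j})$, and let $U_{k,N}(x)=1$ if $\mathsf{SUM}(x)\ge 2^N$ and $U_{k,N}(x)=0$ otherwise. A monotone majority circuit is a directed acyclic graph which may have multiple edges (called wires), with a single node with no outgoing wires, called the output gate. Nodes with no incoming wires are input nodes, each labeled $0$, $1$ or one of the input variables. Every other node (gate) is labeled with a monotone unweighted threshold gate $\mathsf{THR}_{t,m}$ for some integer $t$, where $m$ is its in-degree (counted with multiplicity); it outputs $1$ iff at least $t$ of its $m$ input wires carry the value $1$. The size of a gate $\mathsf{THR}_{t,m}$ is $m$, and the size of a circuit is the sum of the sizes of its gates (i.e. its number of wires). Depth is the maximum number of gates on a directed path from an input node to the output gate (so a depth-$1$ circuit is a single threshold gate applied to input nodes); a depth-$d$ circuit is one of depth at most $d$. -}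

module Defs where

open import Data.Bool.Base using (Bool; true; false; if_then_else_)
open import Data.Fin.Base using (Fin; toℕ)
open import Data.Fin.Induction using (spo-wellFounded)
open import Data.Integer.Base as ℤ using (ℤ; +_)
open import Data.Nat.Base
  using (ℕ; zero; suc; _+_; _*_; _∸_; _^_; _≤_; _≤ᵇ_)
open import Data.Nat.Properties using (+-0-commutativeMonoid)
open import Data.Product.Base using (Σ; _×_; _,_)
open import Induction.WellFounded using (WellFounded; Acc; acc)
open import Relation.Binary.Construct.Closure.ReflexiveTransitive
  using (Star; ε; _◅_)
open import Relation.Binary.Construct.Closure.Transitive
  using (TransClosure; transitive; wellFounded⁻)
open import Relation.Binary.PropositionalEquality
  using (_≡_; refl; isEquivalence; resp₂)
open import Relation.Nullary using (¬_)

open import Algebra.Properties.CommutativeMonoid.Sum +-0-commutativeMonoid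
  using (sum; sum-syntax)

bit : Bool → ℕ
bit b = if b then 1 else 0

-- Column j : Fin N stands for the 1-based column suc (toℕ j), so the weight
-- 2^(N − j) of the 1-based column j becomes 2 ^ (N ∸ suc (toℕ j)).
SUM : (k N : ℕ) → (Fin k × Fin N → Bool) → ℕ
SUM k N x = ∑[ j < N ] (2 ^ (N ∸ suc (toℕ j)) * ∑[ i < k ] bit (x (i , j)))

U : (k N : ℕ) → (Fin k × Fin N → Bool) → Bool
U k N x = 2 ^ N ≤ᵇ SUM k N x

THR : ℤ → (m : ℕ) → (Fin m → Bool) → Bool
THR t m b = t ℤ.≤ᵇ + (∑[ p < m ] bit (b p))

data InputLabel (X : Set) : Set where
  const : Bool → InputLabel X
  var   : X → InputLabel X

-- The label of a node of in-degree m: a node without incoming wires is an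
-- input node; any other node is a gate THR t m, given by its threshold t.
Label : Set → ℕ → Set
Label X zero    = InputLabel X
Label X (suc _) = ℤ

apply : ∀ {X} m → Label X m → (X → Bool) → (Fin m → Bool) → Bool
apply zero    (const b) x _ = b
apply zero    (var v)   x _ = x v
apply (suc m) t         x b = THR t (suc m) b

-- The wires into a node i are indexed by Fin (indegree i); parallel wires are
-- allowed because source i need not be injective.
record Circuit (X : Set) : Set where
  field
    nodes    : ℕ
    indegree : Fin nodes → ℕ
    source   : (i : Fin nodes) → Fin (indegree i) → Fin nodes
    label    : (i : Fin nodes) → Label X (indegree i)

  Wire : Fin nodes → Fin nodes → Set
  Wire i j = Σ (Fin (indegree j)) λ p → source j p ≡ i

  IsSink : Fin nodes → Set
  IsSink i = ∀ j → ¬ Wire i j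

  field
    acyclic     : ∀ i → ¬ TransClosure Wire i i
    output      : Fin nodes
    output-sink : IsSink output
    sink-unique : ∀ i → IsSink i → i ≡ output

  wire-wellFounded : WellFounded Wire
  wire-wellFounded = wellFounded⁻ Wire (spo-wellFounded record
    { isEquivalence = isEquivalence
    ; irrefl        = λ { {i} refl → acyclic i }
    ; trans         = transitive Wire
    ; <-resp-≈      = resp₂ (TransClosure Wire)
    })

  valueAcc : (X → Bool) → (i : Fin nodes) → Acc Wire i → Bool
  valueAcc x i (acc rs) =
    apply (indegree i) (label i) x λ p → valueAcc x (source i p) (rs (p , refl))

  value : (X → Bool) → Fin nodes → Bool
  value x i = valueAcc x i (wire-wellFounded i)

  eval : (X → Bool) → Bool
  eval x = value x output

  -- Input nodes have in-degree 0 and so contribute nothing.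
  size : ℕ
  size = ∑[ i < nodes ] indegree i

  IsInput : Fin nodes → Set
  IsInput i = indegree i ≡ 0

  isGate : Fin nodes → Bool
  isGate i = 1 ≤ᵇ indegree i

  gatesOn : ∀ {i j} → Star Wire i j → ℕ
  gatesOn {i} ε       = bit (isGate i)
  gatesOn {i} (_ ◅ π) = bit (isGate i) + gatesOn π

  Depth≤ : ℕ → Set
  Depth≤ d = ∀ i → IsInput i → (π : Star Wire i output) → gatesOn π ≤ d

Computes : ∀ {X} → Circuit X → ((X → Bool) → Bool) → Set
Computes C f = ∀ x → Circuit.eval C x ≡ f x

-- s ≥ 2^(a/b) for the real power of 2 with rational exponent a/b, where b > 0:
-- both sides are nonnegative, so they may be compared after raising them to
-- the power b.
infix 4 _≥2^_/_
_≥2^_/_ : (s a b : ℕ) → Set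
s ≥2^ a / b = 2 ^ a ≤ s ^ b

-- By induction on k we build finite families of pairs of inputs with k rows, one accepted and
-- one rejected by U, such that every small depth-k threshold formula separates only a small
-- fraction of the pairs.  A pair consists of T blocks: random neutral blocks before a random
-- position J, then a positive block followed by zeros, or a negative block followed by ones.
-- Subformulas of depth k can rarely tell the positive block from one neutral block (neu₁), or
-- a second neutral block (neu₂) from the negative one.  Call a subformula undecided if the
-- completions of the blocks read so far by zeros and by ones give it different values.  If
-- the top gate separates the pair at J, then the positive and the negative block together
-- determine as many undecided subformulas as there are, and a random choice of neu₁ or neu₂
-- in block J decides about half of them.  The number of undecided subformulas therefore
-- halves at almost every separated position, which makes these positions few; an expectation
-- argument with a logarithmic potential turns this into the fraction of separated pairs.
-- Blocks for k + 1 rows come from pairs for k rows by filling the new row, which shifts the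
-- value by a constant.  For single gates, the columns 10 and 01 together have the weight of 11.

module Submission where

open import Defs
open import Data.Bool.Base as Bool using (Bool; true; false; _∧_; not; f≤t; b≤b)
open import Data.Bool.Properties as Bool using (T-≡)
open import Data.Fin.Base using (Fin; zero; suc)
open import Data.Integer.Base as ℤ using (-[1+_])
open import Data.List.Base using (List; []; _∷_; _++_; map; replicate; concatMap)
open import Data.Nat.Base using
  (ℕ; zero; suc; _+_; _*_; _∸_; _^_; _⊓_; _≤_; _≥_; _<_; _≤ᵇ_; z≤n; s≤s; s≤s⁻¹; NonZero; >-nonZero)
import Data.Nat.DivMod as DivMod
open import Data.Nat.Properties
open import Data.Nat.Tactic.RingSolver using (solve-∀)
open import Data.Product.Base using (Σ-syntax; ∃; _×_; _,_; proj₁; proj₂)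
open import Data.Sum.Base using (_⊎_; inj₁; inj₂)
open import Data.Vec.Base as Vec using (Vec; []; _∷_; lookup)
open import Data.Vec.Properties using (lookup-zipWith)
open import Data.Vec.Relation.Binary.Pointwise.Inductive as Pointwise using (Pointwise; []; _∷_)
open import Function.Base using (_∘_)
open import Function.Bundles using (Equivalence)
open import Induction.WellFounded using (Acc; acc)
open import Relation.Binary.Construct.Closure.ReflexiveTransitive using (Star; ε; _◅_; _◅◅_)
open import Relation.Binary.PropositionalEquality
open import Algebra.Properties.CommutativeMonoid.Sum +-0-commutativeMonoid
  using (sum; ∑-distrib-+; sum-cong-≗)
open import Relation.Nullary using (¬_; yes; no; contradiction)
open import Relation.Nullary.Decidable using (decidable-stable)

private variable
  A A′ : Set
  X X′ : Set
  k ℓ L M m n : ℕ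

-- Sums

∑ᴸ : List A → (A → ℕ) → ℕ
∑ᴸ []       f = 0
∑ᴸ (x ∷ xs) f = f x + ∑ᴸ xs f

∣_∣ : List A → ℕ
∣ xs ∣ = ∑ᴸ xs (λ _ → 1)

∑ᴸ-cong : (xs : List A) {f g : A → ℕ} → (∀ x → f x ≡ g x) → ∑ᴸ xs f ≡ ∑ᴸ xs g
∑ᴸ-cong []       f≡g = refl
∑ᴸ-cong (x ∷ xs) f≡g = cong₂ _+_ (f≡g x) (∑ᴸ-cong xs f≡g)

∑ᴸ-mono : (xs : List A) {f g : A → ℕ} → (∀ x → f x ≤ g x) → ∑ᴸ xs f ≤ ∑ᴸ xs g
∑ᴸ-mono []       f≤g = z≤n
∑ᴸ-mono (x ∷ xs) f≤g = +-mono-≤ (f≤g x) (∑ᴸ-mono xs f≤g)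

∑ᴸ-+ : (xs : List A) (f g : A → ℕ) → ∑ᴸ xs (λ x → f x + g x) ≡ ∑ᴸ xs f + ∑ᴸ xs g
∑ᴸ-+ []       f g = refl
∑ᴸ-+ (x ∷ xs) f g rewrite ∑ᴸ-+ xs f g = lemma (f x) (g x) (∑ᴸ xs f) (∑ᴸ xs g)
  where
  lemma : ∀ a b c d → a + b + (c + d) ≡ a + c + (b + d)
  lemma = solve-∀

∑ᴸ-* : (xs : List A) (c : ℕ) (f : A → ℕ) → ∑ᴸ xs (λ x → c * f x) ≡ c * ∑ᴸ xs f
∑ᴸ-* []       c f = sym (*-zeroʳ c)
∑ᴸ-* (x ∷ xs) c f rewrite ∑ᴸ-* xs c f = sym (*-distribˡ-+ c (f x) _)

∑ᴸ-const : (xs : List A) (c : ℕ) → ∑ᴸ xs (λ _ → c) ≡ c * ∣ xs ∣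
∑ᴸ-const xs c = trans (∑ᴸ-cong xs (λ _ → sym (*-identityʳ c))) (∑ᴸ-* xs c _)

∑ᴸ-≤-const : (xs : List A) {f : A → ℕ} (c : ℕ) → (∀ x → f x ≤ c) → ∑ᴸ xs f ≤ c * ∣ xs ∣
∑ᴸ-≤-const xs c f≤c = ≤-trans (∑ᴸ-mono xs f≤c) (≤-reflexive (∑ᴸ-const xs c))

∑ᴸ-zero : (xs : List A) {f : A → ℕ} → (∀ x → f x ≡ 0) → ∑ᴸ xs f ≡ 0
∑ᴸ-zero xs f≡0 = trans (∑ᴸ-cong xs f≡0) (∑ᴸ-const xs 0)

∑ᴸ-++ : (xs ys : List A) (f : A → ℕ) → ∑ᴸ (xs ++ ys) f ≡ ∑ᴸ xs f + ∑ᴸ ys f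
∑ᴸ-++ []       ys f = refl
∑ᴸ-++ (x ∷ xs) ys f rewrite ∑ᴸ-++ xs ys f = sym (+-assoc (f x) _ _)

∑ᴸ-map : (h : A → A′) (xs : List A) (f : A′ → ℕ) → ∑ᴸ (map h xs) f ≡ ∑ᴸ xs (f ∘ h)
∑ᴸ-map h []       f = refl
∑ᴸ-map h (x ∷ xs) f = cong (f (h x) +_) (∑ᴸ-map h xs f)

∑ᴸ-replicate : ∀ n (x : A) (f : A → ℕ) → ∑ᴸ (replicate n x) f ≡ n * f x
∑ᴸ-replicate zero    x f = refl
∑ᴸ-replicate (suc n) x f = cong (f x +_) (∑ᴸ-replicate n x f)

∑ᴸ-concatMap : (h : A → List A′) (xs : List A) (f : A′ → ℕ) →
  ∑ᴸ (concatMap h xs) f ≡ ∑ᴸ xs (λ x → ∑ᴸ (h x) f)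
∑ᴸ-concatMap h []       f = refl
∑ᴸ-concatMap h (x ∷ xs) f =
  trans (∑ᴸ-++ (h x) _ f) (cong (∑ᴸ (h x) f +_) (∑ᴸ-concatMap h xs f))

sum-mono : {f g : Fin m → ℕ} → (∀ i → f i ≤ g i) → sum f ≤ sum g
sum-mono {zero}  f≤g = z≤n
sum-mono {suc m} f≤g = +-mono-≤ (f≤g zero) (sum-mono (f≤g ∘ suc))

sum-*ʳ : (f : Fin m → ℕ) (c : ℕ) → sum (λ i → f i * c) ≡ sum f * c
sum-*ʳ {zero}  f c = refl
sum-*ʳ {suc m} f c rewrite sum-*ʳ (f ∘ suc) c = sym (*-distribʳ-+ c (f zero) _)

≤-sum : (f : Fin m → ℕ) (i : Fin m) → f i ≤ sum f
≤-sum f zero    = m≤m+n (f zero) _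
≤-sum f (suc i) = ≤-trans (≤-sum (f ∘ suc) i) (m≤n+m _ (f zero))

∑ᴸ-sum-swap : (xs : List A) (f : A → Fin m → ℕ) →
  ∑ᴸ xs (λ x → sum (f x)) ≡ sum (λ i → ∑ᴸ xs (λ x → f x i))
∑ᴸ-sum-swap {m = m} [] f = sym (lemma m)
  where
  lemma : ∀ m → sum {m} (λ _ → 0) ≡ 0
  lemma zero    = refl
  lemma (suc m) = lemma m
∑ᴸ-sum-swap (x ∷ xs) f rewrite ∑ᴸ-sum-swap xs f =
  sym (∑-distrib-+ (f x) (λ i → ∑ᴸ xs (λ y → f y i)))

-- Truth values

bit-mono : ∀ {p q} → p Bool.≤ q → bit p ≤ bit q
bit-mono f≤t = z≤n
bit-mono b≤b = ≤-refl

bit≤1 : ∀ p → bit p ≤ 1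
bit≤1 false = z≤n
bit≤1 true  = ≤-refl

≤ᵇ⁺ : m ≤ n → (m ≤ᵇ n) ≡ true
≤ᵇ⁺ m≤n = Equivalence.to T-≡ (≤⇒≤ᵇ m≤n)

≤ᵇ⁻ : (m ≤ᵇ n) ≡ true → m ≤ n
≤ᵇ⁻ {m} {n} eq = ≤ᵇ⇒≤ m n (Equivalence.from T-≡ eq)

≰ᵇ⁻ : (m ≤ᵇ n) ≡ false → n < m
≰ᵇ⁻ eq = ≰⇒> λ m≤n → contradiction (trans (sym eq) (≤ᵇ⁺ m≤n)) λ ()

≤ᵇ-mono : ∀ t → m ≤ n → (t ≤ᵇ m) Bool.≤ (t ≤ᵇ n)
≤ᵇ-mono {m} {n} t m≤n with t ≤ᵇ m in eq
... | false = Bool.≤-minimum (t ≤ᵇ n)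
... | true rewrite ≤ᵇ⁺ (≤-trans (≤ᵇ⁻ {t} eq) m≤n) = b≤b

-- Serves two purposes: on the values of one gate at two inputs it marks a separation or an error,
-- and on the values at `ones` and `zeros` it marks an undecided gate.
viol : Bool → Bool → ℕ
viol p q = bit (p ∧ not q)

bit≤bit+viol : ∀ p q → bit p ≤ bit q + viol p q
bit≤bit+viol false q     = z≤n
bit≤bit+viol true  false = ≤-refl
bit≤bit+viol true  true  = ≤-refl

viol-mono : ∀ p p′ q q′ → p Bool.≤ p′ → q′ Bool.≤ q → viol p q ≤ viol p′ q′
viol-mono false p′ q q′ p≤ q≤ = z≤n
viol-mono true true q false p≤ q≤ = bit≤1 (not q)
viol-mono true true true true p≤ b≤b = ≤-refl

viol-threshold : ∀ t a b → viol (t ≤ᵇ a) (t ≤ᵇ b) ≡ 0 ⊎ (viol (t ≤ᵇ a) (t ≤ᵇ b) ≡ 1 × t ≤ a × b < t)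
viol-threshold t a b with t ≤ᵇ a in eqa | t ≤ᵇ b in eqb
... | false | _     = inj₁ refl
... | true  | true  = inj₁ refl
... | true  | false = inj₂ (refl , ≤ᵇ⁻ eqa , ≰ᵇ⁻ eqb)

separated : ∀ {a b t} → a ≡ t → b + suc n ≡ t → viol (t ≤ᵇ a) (t ≤ᵇ b) ≡ 1
separated {n} {b = b} {t} a≡t b+n≡t with t ≤ᵇ b in eq
... | true  = contradiction (≤ᵇ⁻ {t} eq) (<⇒≱ (subst (b <_) b+n≡t (m<m+n b (s≤s z≤n))))
... | false rewrite ≤ᵇ⁺ (≤-reflexive (sym a≡t)) = refl

count : (Fin m → Bool) → ℕ
count b = sum (bit ∘ b)

count≤ : (b : Fin m → Bool) → count b ≤ m
count≤ {zero}  b = z≤n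
count≤ {suc m} b = +-mono-≤ (bit≤1 (b zero)) (count≤ (b ∘ suc))

-- Threshold formulas

data Literal (at : X → A → Bool) (f : A → Bool) : Set where
  constant   : ∀ b → (∀ x → f x ≡ b) → Literal at f
  coordinate : ∀ v → (∀ x → f x ≡ at v x) → Literal at f

-- A formula is identified with the function it computes. Only the in-degrees are bounded, by `B`,
-- and the depth is exactly `ℓ`; shallower formulas are padded with one-input gates.
Threshold : (B : ℕ) (at : X → A → Bool) → ℕ → (A → Bool) → Set
Threshold         B at zero    f = Literal at f
Threshold {A = A} B at (suc ℓ) f =
  Σ[ m ∈ ℕ ] Σ[ t ∈ ℕ ] Σ[ g ∈ (Fin m → A → Bool) ]
    m ≤ B × (∀ i → Threshold B at ℓ (g i)) × (∀ x → f x ≡ (t ≤ᵇ count λ i → g i x))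

module _ {at : X → A → Bool} {at′ : X′ → A′ → Bool} (e : A′ → A)
         (literal : ∀ v → Literal at′ (at v ∘ e)) where

  -- Substitution acts only at the leaves, so depth and in-degrees survive. This covers fixing a
  -- prefix, a suffix or a new row.
  Threshold-∘ : ∀ {B f} ℓ → Threshold B at ℓ f → Threshold B at′ ℓ (f ∘ e)
  Threshold-∘ zero (constant b f≡b) = constant b (f≡b ∘ e)
  Threshold-∘ zero (coordinate v f≡v) with literal v
  ... | constant b v≡b    = constant b λ x → trans (f≡v (e x)) (v≡b x)
  ... | coordinate w v≡w  = coordinate w λ x → trans (f≡v (e x)) (v≡w x)
  Threshold-∘ (suc ℓ) (m , t , g , m≤B , thr , f≡) =
    m , t , (λ i → g i ∘ e) , m≤B , (λ i → Threshold-∘ ℓ (thr i)) , f≡ ∘ e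

module _ {B : ℕ} {at : X → A → Bool} (1≤B : 1 ≤ B) where

  Threshold-suc : ∀ {f} → Threshold B at ℓ f → Threshold B at (suc ℓ) f
  Threshold-suc {f = f} thr = 1 , 1 , (λ _ → f) , 1≤B , (λ _ → thr) , λ x → lemma (f x)
    where
    lemma : ∀ b → b ≡ (1 ≤ᵇ bit b + 0)
    lemma false = refl
    lemma true  = refl

  Literal⇒Threshold : ∀ {f} ℓ → Literal at f → Threshold B at ℓ f
  Literal⇒Threshold zero    lit = lit
  Literal⇒Threshold {f = f} (suc ℓ) lit = Threshold-suc {ℓ = ℓ} {f = f} (Literal⇒Threshold ℓ lit)

module _ {B : ℕ} {at : X → A → Bool} {x y : A} (x⊑y : ∀ v → at v x Bool.≤ at v y) where

  Threshold-mono : ∀ {f} ℓ → Threshold B at ℓ f → f x Bool.≤ f y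
  Threshold-mono zero (constant b f≡b) rewrite f≡b x | f≡b y = b≤b
  Threshold-mono zero (coordinate v f≡v) rewrite f≡v x | f≡v y = x⊑y v
  Threshold-mono (suc ℓ) (m , t , g , m≤B , thr , f≡) rewrite f≡ x | f≡ y =
    ≤ᵇ-mono t (sum-mono λ i → bit-mono (Threshold-mono ℓ (thr i)))

-- Inputs

Input : (k L : ℕ) → Set
Input k L = Vec (Vec Bool k) L

at : Fin k × Fin L → Input k L → Bool
at (i , j) x = lookup (lookup x j) i

val : Input k L → ℕ
val {k} {L} x = SUM k L λ v → at v x

weight : Vec Bool k → ℕ
weight c = sum λ i → bit (lookup c i)

constInput : Bool → Input k L
constInput b = Vec.replicate _ (Vec.replicate _ b)

zeros ones : Input k L
zeros = constInput false
ones  = constInput true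

val-++ : (x : Input k L) (y : Input k M) → val (x Vec.++ y) ≡ val x * 2 ^ M + val y
val-++ []      y = refl
val-++ {L = suc L} {M = M} (c ∷ x) y rewrite val-++ x y | ^-distribˡ-+-* 2 L M =
  lemma (2 ^ L) (2 ^ M) (weight c) (val x) (val y)
  where
  lemma : ∀ l m w a b → l * m * w + (a * m + b) ≡ (l * w + a) * m + b
  lemma = solve-∀

weight-false : ∀ k → weight (Vec.replicate k false) ≡ 0
weight-false zero    = refl
weight-false (suc k) = weight-false k

weight-true : ∀ k → weight (Vec.replicate k true) ≡ k
weight-true zero    = refl
weight-true (suc k) = cong suc (weight-true k)

val-zeros : ∀ k L → val (zeros {k} {L}) ≡ 0
val-zeros k zero    = refl
val-zeros k (suc L) rewrite weight-false k | *-zeroʳ (2 ^ L) = val-zeros k L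

val-ones : ∀ k L → val (ones {k} {L}) + k ≡ k * 2 ^ L
val-ones k zero    = sym (*-identityʳ k)
val-ones k (suc L) rewrite weight-true k =
  trans (+-assoc (2 ^ L * k) _ k) (trans (cong (2 ^ L * k +_) (val-ones k L)) (lemma (2 ^ L) k))
  where
  lemma : ∀ l k → l * k + k * l ≡ k * (2 * l)
  lemma = solve-∀

infix 4 _⊑_
_⊑_ : Input k L → Input k L → Set
_⊑_ = Pointwise (Pointwise Bool._≤_)

⊑-refl : {x : Input k L} → x ⊑ x
⊑-refl = Pointwise.refl (Pointwise.refl Bool.≤-refl)

⊑-at : {x y : Input k L} → x ⊑ y → ∀ v → at v x Bool.≤ at v y
⊑-at x⊑y (i , j) = Pointwise.lookup (Pointwise.lookup x⊑y j) i

zeros-⊑ : (x : Input k L) → zeros ⊑ x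
zeros-⊑ []      = []
zeros-⊑ (c ∷ x) = column c ∷ zeros-⊑ x
  where
  column : ∀ {k} (c : Vec Bool k) → Pointwise Bool._≤_ (Vec.replicate k false) c
  column []      = []
  column (b ∷ c) = Bool.≤-minimum b ∷ column c

⊑-ones : (x : Input k L) → x ⊑ ones
⊑-ones []      = []
⊑-ones (c ∷ x) = column c ∷ ⊑-ones x
  where
  column : ∀ {k} (c : Vec Bool k) → Pointwise Bool._≤_ c (Vec.replicate k true)
  column []      = []
  column (b ∷ c) = Bool.≤-maximum b ∷ column c

++-⊑ : {x y : Input k L} {x′ y′ : Input k M} → x ⊑ y → x′ ⊑ y′ → (x Vec.++ x′) ⊑ (y Vec.++ y′)
++-⊑ = Pointwise.++⁺

prefix-literal : (z : Input k L) (v : Fin k × Fin (L + M)) →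
  Literal at (λ (x : Input k M) → at v (z Vec.++ x))
prefix-literal []      v           = coordinate v λ _ → refl
prefix-literal (c ∷ z) (i , zero)  = constant (lookup c i) λ _ → refl
prefix-literal (c ∷ z) (i , suc j) = prefix-literal z (i , j)

suffix-literal : (q : Input k M) (v : Fin k × Fin (L + M)) →
  Literal at (λ (x : Input k L) → at v (x Vec.++ q))
suffix-literal {L = zero}  q v           = constant (at v q) λ { [] → refl }
suffix-literal {L = suc L} q (i , zero)  = coordinate (i , zero) λ { (c ∷ x) → refl }
suffix-literal {L = suc L} q (i , suc j) with suffix-literal {L = L} q (i , j)
... | constant b h             = constant b λ { (c ∷ x) → h x }
... | coordinate (i′ , j′) h   = coordinate (i′ , suc j′) λ { (c ∷ x) → h x }

addRow : Vec Bool L → Input k L → Input (suc k) L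
addRow = Vec.zipWith _∷_

addRow-literal : (c : Vec Bool (suc k)) (r : Vec Bool L) (v : Fin (suc k) × Fin (suc L)) →
  Literal at (λ x → at v (c ∷ addRow r x))
addRow-literal c r (i , zero) = constant (lookup c i) λ _ → refl
addRow-literal c r (zero , suc j) =
  constant (lookup r j) λ x → cong (λ c → lookup c zero) (lookup-zipWith _∷_ j r x)
addRow-literal c r (suc i , suc j) =
  coordinate (i , j) λ x → cong (λ c → lookup c (suc i)) (lookup-zipWith _∷_ j r x)

addRow-⊑ : {r r′ : Vec Bool L} → Pointwise Bool._≤_ r r′ → (x : Input k L) → addRow r x ⊑ addRow r′ x
addRow-⊑ []       []      = []
addRow-⊑ (p ∷ ps) (c ∷ x) = (p ∷ Pointwise.refl Bool.≤-refl) ∷ addRow-⊑ ps x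

rowVal : Vec Bool L → ℕ
rowVal []              = 0
rowVal {suc L} (b ∷ r) = 2 ^ L * bit b + rowVal r

val-addRow : (r : Vec Bool L) (x : Input k L) → val (addRow r x) ≡ rowVal r + val x
val-addRow []              []      = refl
val-addRow {suc L} (b ∷ r) (c ∷ x) rewrite val-addRow r x =
  lemma (2 ^ L) (bit b) (weight c) (rowVal r) (val x)
  where
  lemma : ∀ l b w r v → l * (b + w) + (r + v) ≡ l * b + r + (l * w + v)
  lemma = solve-∀

rowVal-false : ∀ L → rowVal (Vec.replicate L false) ≡ 0
rowVal-false zero    = refl
rowVal-false (suc L) rewrite *-zeroʳ (2 ^ L) = rowVal-false L

rowVal-true : ∀ L → suc (rowVal (Vec.replicate L true)) ≡ 2 ^ L
rowVal-true zero    = refl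
rowVal-true (suc L) rewrite *-identityʳ (2 ^ L) | +-identityʳ (2 ^ L) =
  trans (sym (+-suc (2 ^ L) _)) (cong (2 ^ L +_) (rowVal-true L))

binary : ∀ L n → n < 2 ^ L → Σ[ r ∈ Vec Bool L ] rowVal r ≡ n
binary zero    zero    _           = [] , refl
binary zero    (suc n) (s≤s ())
binary (suc L) n       n<2^1+L with 2 ^ L ≤? n
... | no n≱2^L = let r , eq = binary L n (≰⇒> n≱2^L) in
  false ∷ r , trans (cong (_+ rowVal r) (*-zeroʳ (2 ^ L))) eq
... | yes 2^L≤n = let r , eq = binary L (n ∸ 2 ^ L) n-2^L<2^L in
  true ∷ r , trans (cong₂ _+_ (*-identityʳ (2 ^ L)) eq) (m+[n∸m]≡n 2^L≤n)
  where
  n-2^L<2^L : n ∸ 2 ^ L < 2 ^ L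
  n-2^L<2^L = +-cancelˡ-< (2 ^ L) _ _ (subst₂ _<_ (sym (m+[n∸m]≡n 2^L≤n))
    (cong (2 ^ L +_) (+-identityʳ (2 ^ L))) n<2^1+L)

-- The logarithmic potential

module Potential where

  -- Up to scaling, a piecewise linear substitute for the logarithm.
  Ψ : ℕ → ℕ → ℕ
  Ψ zero    u = 1 ⊓ u
  Ψ (suc m) u = 2 * Ψ m u + (2 ^ suc m ⊓ u)

  Ψ-mono : ∀ m {u v} → v ≤ u → Ψ m v ≤ Ψ m u
  Ψ-mono zero    v≤u = ⊓-monoʳ-≤ 1 v≤u
  Ψ-mono (suc m) v≤u = +-mono-≤ (*-monoʳ-≤ 2 (Ψ-mono m v≤u)) (⊓-monoʳ-≤ (2 ^ suc m) v≤u)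

  Ψ-bound : ∀ m u → Ψ m u ≤ 2 ^ m * suc m
  Ψ-bound zero    u = m⊓n≤m 1 u
  Ψ-bound (suc m) u = begin
    2 * Ψ m u + (2 ^ suc m ⊓ u)       ≤⟨ +-mono-≤ (*-monoʳ-≤ 2 (Ψ-bound m u)) (m⊓n≤m (2 ^ suc m) u) ⟩
    2 * (2 ^ m * suc m) + 2 * 2 ^ m   ≡⟨ lemma (2 ^ m) m ⟩
    2 * 2 ^ m * suc (suc m)           ∎
    where
    open ≤-Reasoning
    lemma : ∀ c m → 2 * (c * suc m) + 2 * c ≡ 2 * c * suc (suc m)
    lemma = solve-∀

  -- The analogue of the tangent bound for the logarithm. Unfolded, `Ψ m u` is the sum over i ≤ m of
  -- 2^(m-i) min(2^i, u). For the least i with u ≤ 2^i, this summand alone drops by 2^(m-i) (u - v),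
  -- where 2^i ≤ 2u unless u = 0; the other summands are monotone.
  Ψ-tangent : ∀ m {u v} → v ≤ u → u ≤ 2 ^ m →
    2 ^ m * u + u * (2 * Ψ m v) ≤ 2 ^ m * v + u * (2 * Ψ m u)
  Ψ-tangent zero {zero} z≤n u≤1 = z≤n
  Ψ-tangent zero {suc zero} {zero} v≤u u≤1 = s≤s z≤n
  Ψ-tangent zero {suc zero} {suc zero} v≤u u≤1 = ≤-refl
  Ψ-tangent zero {suc zero} {suc (suc v)} (s≤s ()) u≤1
  Ψ-tangent zero {suc (suc u)} v≤u (s≤s ())
  Ψ-tangent (suc m) {u} {v} v≤u u≤ with u ≤? 2 ^ m
  ... | yes u≤2^m = begin
    2 * 2 ^ m * u + u * (2 * (2 * Ψ m v + (c ⊓ v)))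
      ≡⟨ lemma (2 ^ m) u u (Ψ m v) (c ⊓ v) ⟩
    2 * (2 ^ m * u + u * (2 * Ψ m v)) + 2 * (u * (c ⊓ v))
      ≤⟨ +-mono-≤ (*-monoʳ-≤ 2 (Ψ-tangent m v≤u u≤2^m)) (*-monoʳ-≤ 2 (*-monoʳ-≤ u (⊓-monoʳ-≤ c v≤u))) ⟩
    2 * (2 ^ m * v + u * (2 * Ψ m u)) + 2 * (u * (c ⊓ u))
      ≡⟨ lemma (2 ^ m) v u (Ψ m u) (c ⊓ u) ⟨
    2 * 2 ^ m * v + u * (2 * (2 * Ψ m u + (c ⊓ u)))   ∎
    where
    open ≤-Reasoning
    c = 2 ^ suc m
    lemma : ∀ c w u p q → 2 * c * w + u * (2 * (2 * p + q)) ≡ 2 * (c * w + u * (2 * p)) + 2 * (u * q)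
    lemma = solve-∀
  ... | no u≰2^m rewrite m≥n⇒m⊓n≡n u≤ | m≥n⇒m⊓n≡n (≤-trans v≤u u≤) = begin
    c * u + u * (2 * (2 * Ψ m v + v))
      ≡⟨ cong (λ w → c * w + u * (2 * (2 * Ψ m v + v))) (sym (m+[n∸m]≡n v≤u)) ⟩
    c * (v + e) + u * (2 * (2 * Ψ m v + v))
      ≡⟨ lemma c v e u (Ψ m v) ⟩
    c * v + (c * e + u * (2 * (2 * Ψ m v + v)))
      ≤⟨ +-monoʳ-≤ (c * v) (+-mono-≤ (*-monoˡ-≤ e (*-monoʳ-≤ 2 (<⇒≤ (≰⇒> u≰2^m))))
           (*-monoʳ-≤ u (*-monoʳ-≤ 2 (+-monoˡ-≤ v (*-monoʳ-≤ 2 (Ψ-mono m v≤u)))))) ⟩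
    c * v + (2 * u * e + u * (2 * (2 * Ψ m u + v)))
      ≡⟨ lemma′ (c * v) u e v (Ψ m u) ⟩
    c * v + u * (2 * (2 * Ψ m u + (v + e)))
      ≡⟨ cong (λ w → c * v + u * (2 * (2 * Ψ m u + w))) (m+[n∸m]≡n v≤u) ⟩
    c * v + u * (2 * (2 * Ψ m u + u))   ∎
    where
    open ≤-Reasoning
    c = 2 ^ suc m
    e = u ∸ v
    lemma : ∀ c v e u p → c * (v + e) + u * (2 * (2 * p + v)) ≡ c * v + (c * e + u * (2 * (2 * p + v)))
    lemma = solve-∀
    lemma′ : ∀ a u e v p → a + (2 * u * e + u * (2 * (2 * p + v))) ≡ a + u * (2 * (2 * p + (v + e)))
    lemma′ = solve-∀

-- Fooling families of input pairs

-- Reading the columns from the left, an input of length L leaves the deficit 2 ^ L - val.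
-- Deficit 0 is preserved by zeros, deficit k by ones; a prefix of deficit 1 is neutral.
record Pair (k L : ℕ) : Set where
  field
    accept reject : Input k L
    val-accept : val accept ≡ 2 ^ L
    val-reject  : val reject + k ≡ 2 ^ L

-- Gates accepting pos tend to accept neu₁, and gates accepting neu₂ tend to accept neg.
record Quad (k L : ℕ) : Set where
  field
    pos neu₁ neu₂ neg : Input k L
    val-pos  : val pos ≡ 2 ^ L
    val-neu₁ : suc (val neu₁) ≡ 2 ^ L
    val-neu₂ : suc (val neu₂) ≡ 2 ^ L
    val-neg  : val neg + k ≡ 2 ^ L

open Pair
open Quad

-- A neutral prefix has deficit 1, which becomes `2 ^ M` over `M` further columns, just as if the
-- suffix stood alone.
prepend : (z : Input k L) → suc (val z) ≡ 2 ^ L → Pair k M → Pair k (L + M)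
prepend z val-z p .accept = z Vec.++ p .accept
prepend z val-z p .reject  = z Vec.++ p .reject
prepend {L = L} {M = M} z val-z p .val-accept
  rewrite val-++ z (p .accept) | p .val-accept | ^-distribˡ-+-* 2 L M | sym val-z = +-comm (val z * 2 ^ M) _
prepend {k} {L} {M} z val-z p .val-reject
  rewrite val-++ z (p .reject) | +-assoc (val z * 2 ^ M) (val (p .reject)) k | p .val-reject
        | ^-distribˡ-+-* 2 L M | sym val-z = +-comm (val z * 2 ^ M) _

closeOff : ∀ M → Quad k L → Pair k (L + M)
closeOff M q .accept = q .pos Vec.++ zeros
closeOff M q .reject  = q .neg Vec.++ ones
closeOff {k} {L} M q .val-accept
  rewrite val-++ (q .pos) (zeros {k} {M}) | q .val-pos | ^-distribˡ-+-* 2 L M | val-zeros k M = +-identityʳ _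
closeOff {k} {L} M q .val-reject
  rewrite val-++ (q .neg) (ones {k} {M}) | +-assoc (val (q .neg) * 2 ^ M) (val (ones {k} {M})) k
        | val-ones k M | ^-distribˡ-+-* 2 L M | sym (q .val-neg) = sym (*-distribʳ-+ (2 ^ M) (val (q .neg)) k)

module Fooling (m R : ℕ) where

  open Potential

  -- `B` bounds the in-degrees, `c` is the scale of the potential `Φ`, and `h` bounds `Φ` in units
  -- of `c`.
  B c h : ℕ
  B = 2 ^ m
  c = 2 ^ m
  h = 2 * suc m

  instance
    c-nonZero : NonZero c
    c-nonZero = m^n≢0 2 m

  1≤B : 1 ≤ B
  1≤B = m^n>0 2 m

  -- Doubling absorbs the factor 2 of `Ψ-tangent`: when u falls to v, `Φ` drops by at least c (u -
  -- v) / u.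
  Φ : ℕ → ℕ
  Φ u = 2 * Ψ m u

  Φ-bound : ∀ u → Φ u ≤ c * h
  Φ-bound u = ≤-trans (*-monoʳ-≤ 2 (Ψ-bound m u)) (≤-reflexive (lemma c (suc m)))
    where
    lemma : ∀ c n → 2 * (c * n) ≡ c * (2 * n)
    lemma = solve-∀

  -- Since `Φ` is monotone, the denominator may grow from `u` to any `w`, in particular to a `w`
  -- that is nonzero when `u` is 0.
  Φ-tangent : ∀ {u v w} → v ≤ u → u ≤ B → u ≤ w → c * u + w * Φ v ≤ c * v + w * Φ u
  Φ-tangent {u} {v} {w} v≤u u≤B u≤w =
    subst (λ w → c * u + w * Φ v ≤ c * v + w * Φ u) (m+[n∸m]≡n u≤w) (begin
    c * u + (u + e) * Φ v          ≡⟨ lemma (c * u) u e (Φ v) ⟩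
    c * u + u * Φ v + e * Φ v      ≤⟨ +-mono-≤ (Ψ-tangent m v≤u u≤B) (*-monoʳ-≤ e (*-monoʳ-≤ 2 (Ψ-mono m v≤u))) ⟩
    c * v + u * Φ u + e * Φ u      ≡⟨ lemma (c * v) u e (Φ u) ⟨
    c * v + (u + e) * Φ u          ∎)
    where
    open ≤-Reasoning
    e = w ∸ u
    lemma : ∀ a u e p → a + (u + e) * p ≡ a + u * p + e * p
    lemma = solve-∀

  -- If a branching step drops the potential argument from u to v₁ or v₂, and this drop pays
  -- for X up to an error E, then the expected drop of Φ pays for X.
  potential-pays : ∀ {u v₁ v₂ w X E} → u ≤ B → u ≤ w → v₁ ≤ u → v₂ ≤ u →
    v₁ + v₂ + X * w ≤ 2 * u + E →
    w * (c * X + (Φ v₁ + Φ v₂)) ≤ w * (2 * Φ u) + c * E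
  potential-pays {u} {v₁} {v₂} {w} {X} {E} u≤B u≤w v₁≤u v₂≤u drop =
    +-cancelʳ-≤ (c * (2 * u + (v₁ + v₂))) _ _ (begin
    w * (c * X + (Φ v₁ + Φ v₂)) + c * (2 * u + (v₁ + v₂))
      ≡⟨ lemma₁ c w X u v₁ v₂ (Φ v₁) (Φ v₂) ⟩
    c * (v₁ + v₂ + X * w) + ((c * u + w * Φ v₁) + (c * u + w * Φ v₂))
      ≤⟨ +-mono-≤ (*-monoʳ-≤ c drop) (+-mono-≤ (Φ-tangent v₁≤u u≤B u≤w) (Φ-tangent v₂≤u u≤B u≤w)) ⟩
    c * (2 * u + E) + ((c * v₁ + w * Φ u) + (c * v₂ + w * Φ u))
      ≡⟨ lemma₂ c w E u v₁ v₂ (Φ u) ⟩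
    w * (2 * Φ u) + c * E + c * (2 * u + (v₁ + v₂))   ∎)
    where
    open ≤-Reasoning
    lemma₁ : ∀ c w X u v₁ v₂ p₁ p₂ → w * (c * X + (p₁ + p₂)) + c * (2 * u + (v₁ + v₂)) ≡
      c * (v₁ + v₂ + X * w) + ((c * u + w * p₁) + (c * u + w * p₂))
    lemma₁ = solve-∀
    lemma₂ : ∀ c w E u v₁ v₂ p → c * (2 * u + E) + ((c * v₁ + w * p) + (c * v₂ + w * p)) ≡
      w * (2 * p) + c * E + c * (2 * u + (v₁ + v₂))
    lemma₂ = solve-∀

  Thr : ℕ → (Input k L → Bool) → Set
  Thr = Threshold B at

  Thr-mono : ∀ ℓ {f : Input k L → Bool} → Thr ℓ f → ∀ {x y} → x ⊑ y → f x Bool.≤ f y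
  Thr-mono ℓ thr x⊑y = Threshold-mono (⊑-at x⊑y) ℓ thr

  Thr-prefix : ∀ ℓ (z : Input k L) {f : Input k (L + M) → Bool} → Thr ℓ f → Thr ℓ (λ x → f (z Vec.++ x))
  Thr-prefix ℓ z = Threshold-∘ (z Vec.++_) (prefix-literal z) ℓ

  Thr-suffix : ∀ ℓ (q : Input k M) {f : Input k (L + M) → Bool} → Thr ℓ f → Thr ℓ (λ (x : Input k L) → f (x Vec.++ q))
  Thr-suffix ℓ q = Threshold-∘ (Vec._++ q) (suffix-literal q) ℓ

  -- The pairs (l x, r x) fool f up to an error probability α / R.
  Fools : ℕ → (xs : List A) (l r : A → Input k L) → (Input k L → Bool) → Set
  Fools α xs l r f = R * ∑ᴸ xs (λ x → viol (f (l x)) (f (r x))) ≤ α * ∣ xs ∣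

  PairFooling : ℕ → ℕ → List (Pair k L) → Set
  PairFooling ℓ α ps = ∀ {f} → Thr ℓ f → Fools α ps accept reject f

  QuadFooling : ℕ → ℕ → List (Quad k L) → Set
  QuadFooling ℓ α qs = ∀ {f} → Thr ℓ f → Fools α qs pos neu₁ f × Fools α qs neu₂ neg f

  -- Chains of blocks: from quads at depth ℓ to pairs at depth ℓ + 1

  module Chain (Ω : List (Quad k L)) where

    W : ℕ
    W = ∣ Ω ∣

    -- Counts the choices of a quad and of `neu₁` or `neu₂` in each of `T` blocks. It is also the
    -- total weight of each position in `chain T`, which is why pairs that close off early are
    -- replicated there.
    prefixes : ℕ → ℕ
    prefixes T = (2 * W) ^ T

    prepend₁ prepend₂ : Quad k L → Pair k M → Pair k (L + M)
    prepend₁ q = prepend (q .neu₁) (q .val-neu₁)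
    prepend₂ q = prepend (q .neu₂) (q .val-neu₂)

    -- The uniform distribution on a position J of T blocks, a quad ω for each block up to J
    -- (the others are irrelevant) and a choice of neu₁ ω or neu₂ ω for each block before J.
    chain : ∀ T → List (Pair k (T * L))
    chain zero    = []
    chain (suc T) =
      concatMap (λ q → replicate (2 * prefixes T) (closeOff (T * L) q)) Ω ++
      concatMap (λ q → map (prepend₁ q) (chain T) ++ map (prepend₂ q) (chain T)) Ω

    ∑-chain : ∀ T (f : Pair k (suc T * L) → ℕ) → ∑ᴸ (chain (suc T)) f ≡
      2 * prefixes T * ∑ᴸ Ω (λ q → f (closeOff (T * L) q)) +
      ∑ᴸ Ω (λ q → ∑ᴸ (chain T) (f ∘ prepend₁ q) + ∑ᴸ (chain T) (f ∘ prepend₂ q))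
    ∑-chain T f = trans (∑ᴸ-++ (concatMap _ Ω) _ f) (cong₂ _+_
      (trans (∑ᴸ-concatMap _ Ω f)
        (trans (∑ᴸ-cong Ω λ q → ∑ᴸ-replicate (2 * prefixes T) (closeOff (T * L) q) f) (∑ᴸ-* Ω (2 * prefixes T) (λ q → f (closeOff (T * L) q)))))
      (trans (∑ᴸ-concatMap _ Ω f) (∑ᴸ-cong Ω λ q →
        trans (∑ᴸ-++ (map (prepend₁ q) (chain T)) _ f)
          (cong₂ _+_ (∑ᴸ-map (prepend₁ q) (chain T) f) (∑ᴸ-map (prepend₂ q) (chain T) f)))))

    ∣chain∣ : ∀ T → ∣ chain T ∣ ≡ T * prefixes T
    ∣chain∣ zero    = refl
    ∣chain∣ (suc T) rewrite ∑-chain T (λ _ → 1) | ∑ᴸ-const Ω (∣ chain T ∣ + ∣ chain T ∣) | ∣chain∣ T =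
      lemma T W (prefixes T)
      where
      lemma : ∀ T W N → 2 * N * W + (T * N + T * N) * W ≡ suc T * (2 * W * N)
      lemma = solve-∀

    -- For monotone `g`, the number of undecided gates.
    gap : (Fin n → Input k M → Bool) → ℕ
    gap g = sum λ i → viol (g i ones) (g i zeros)

    module _ {ℓ α : ℕ} (fooling : QuadFooling ℓ α Ω) where

      -- A gate that no completion of the block can flip makes no errors.
      undecided-error : (l r : Quad k L → Input k L) → (∀ {f} → Thr ℓ f → Fools α Ω l r f) →
        (s : Input k M) {f : Input k (L + M) → Bool} → Thr ℓ f →
        R * ∑ᴸ Ω (λ q → viol (f (l q Vec.++ s)) (f (r q Vec.++ s)))
          ≤ viol (f ones) (f zeros) * (α * W)
      undecided-error l r fools s {f} thr = bound (viol (f ones) (f zeros)) refl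
        where
        err : Quad k L → ℕ
        err q = viol (f (l q Vec.++ s)) (f (r q Vec.++ s))
        err≤ : ∀ q → err q ≤ viol (f ones) (f zeros)
        err≤ q = viol-mono _ _ _ _ (Thr-mono ℓ thr (⊑-ones _)) (Thr-mono ℓ thr (zeros-⊑ _))
        bound : ∀ v → viol (f ones) (f zeros) ≡ v → R * ∑ᴸ Ω err ≤ v * (α * W)
        bound zero eq = ≤-reflexive (trans (cong (R *_)
          (∑ᴸ-zero Ω λ q → n≤0⇒n≡0 (≤-trans (err≤ q) (≤-reflexive eq)))) (*-zeroʳ R))
        bound (suc v) eq = ≤-trans (fools (Thr-suffix ℓ s thr)) (m≤m+n (α * W) _)

      module Step {M j} (g : Fin j → Input k (L + M) → Bool) (j≤B : j ≤ B)
                  (thr : ∀ i → Thr ℓ (g i)) (t : ℕ) where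

        F : Input k (L + M) → ℕ
        F x = count λ i → g i x

        after : Input k L → ℕ
        after z = gap λ i x → g i (z Vec.++ x)

        bad : Quad k L → ℕ
        bad q = viol (t ≤ᵇ F (q .pos Vec.++ zeros)) (t ≤ᵇ F (q .neg Vec.++ ones))

        err₁ err₂ err : Quad k L → ℕ
        err₁ q = sum λ i → viol (g i (q .pos Vec.++ zeros)) (g i (q .neu₁ Vec.++ zeros))
        err₂ q = sum λ i → viol (g i (q .neu₂ Vec.++ ones)) (g i (q .neg Vec.++ ones))
        err q = err₁ q + err₂ q

        u : ℕ
        u = gap g

        F-mono : ∀ {x y} → x ⊑ y → F x ≤ F y
        F-mono x⊑y = sum-mono λ i → bit-mono (Thr-mono ℓ (thr i) x⊑y)

        F-error : ∀ x y → F x ≤ F y + sum (λ i → viol (g i x) (g i y))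
        F-error x y = ≤-trans (sum-mono λ i → bit≤bit+viol (g i x) (g i y))
          (≤-reflexive (∑-distrib-+ (λ i → bit (g i y)) _))

        F-gap : ∀ {x y} → x ⊑ y → sum (λ i → viol (g i y) (g i x)) + F x ≡ F y
        F-gap {x} {y} x⊑y = trans (sym (∑-distrib-+ (λ i → viol (g i y) (g i x)) _))
          (sum-cong-≗ λ i → lemma (Thr-mono ℓ (thr i) x⊑y))
          where
          lemma : ∀ {p q} → p Bool.≤ q → viol q p + bit p ≡ bit q
          lemma f≤t = refl
          lemma {false} b≤b = refl
          lemma {true}  b≤b = refl

        after≤u : ∀ z → after z ≤ u
        after≤u z = sum-mono λ i → viol-mono _ _ _ _
          (Thr-mono ℓ (thr i) (⊑-ones _)) (Thr-mono ℓ (thr i) (zeros-⊑ _))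

        u≤B : u ≤ B
        u≤B = ≤-trans (count≤ _) j≤B

        -- If the top gate accepts closeOff's first input and rejects its second, there are more accepting
        -- gates on the former; up to errors these stay accepting under neu₁, and the gates
        -- rejecting the latter stay rejecting under neu₂.
        drop : ∀ q → after (q .neu₁) + after (q .neu₂) + bad q * suc u ≤ 2 * u + err q
        drop q with viol-threshold t (F (q .pos Vec.++ zeros)) (F (q .neg Vec.++ ones))
        ... | inj₁ bad≡0 rewrite bad≡0 = begin
          v₁ + v₂ + 0     ≡⟨ +-identityʳ (v₁ + v₂) ⟩
          v₁ + v₂         ≤⟨ +-mono-≤ (after≤u (q .neu₁)) (after≤u (q .neu₂)) ⟩
          u + u           ≡⟨ cong (u +_) (+-identityʳ u) ⟨
          2 * u           ≤⟨ m≤m+n (2 * u) (err q) ⟩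
          2 * u + err q   ∎
          where
          open ≤-Reasoning
          v₁ = after (q .neu₁)
          v₂ = after (q .neu₂)
        ... | inj₂ (bad≡1 , t≤Fy , Fn<t) rewrite bad≡1 = +-cancelʳ-≤ (L₁ + L₂) _ _ (begin
          v₁ + v₂ + (suc u + 0) + (L₁ + L₂)
            ≡⟨ lemma₁ v₁ v₂ u L₁ L₂ ⟩
          (v₁ + L₁) + (v₂ + L₂) + suc u
            ≡⟨ cong₂ (λ a b → a + b + suc u) (F-gap (++-⊑ (⊑-refl {x = q .neu₁}) (zeros-⊑ ones)))
                 (F-gap (++-⊑ (⊑-refl {x = q .neu₂}) (zeros-⊑ ones))) ⟩
          F (q .neu₁ Vec.++ ones) + F (q .neu₂ Vec.++ ones) + suc u
            ≤⟨ +-monoˡ-≤ (suc u) (+-mono-≤ (F-mono (⊑-ones _)) (F-error (q .neu₂ Vec.++ ones) (q .neg Vec.++ ones))) ⟩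
          F ones + (Fn + err₂ q) + suc u
            ≡⟨ cong (λ a → a + (Fn + err₂ q) + suc u) (F-gap (zeros-⊑ ones)) ⟨
          (u + F zeros) + (Fn + err₂ q) + suc u
            ≡⟨ lemma₂ u (F zeros) Fn (err₂ q) ⟩
          2 * u + F zeros + suc Fn + err₂ q
            ≤⟨ +-monoˡ-≤ (err₂ q) (+-mono-≤ (+-monoʳ-≤ (2 * u) (F-mono (zeros-⊑ _))) (≤-trans Fn<t (≤-trans t≤Fy
                 (F-error (q .pos Vec.++ zeros) (q .neu₁ Vec.++ zeros))))) ⟩
          2 * u + L₂ + (L₁ + err₁ q) + err₂ q
            ≡⟨ lemma₃ (2 * u) L₁ L₂ (err₁ q) (err₂ q) ⟩
          2 * u + err q + (L₁ + L₂)   ∎)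
          where
          open ≤-Reasoning
          v₁ = after (q .neu₁)
          v₂ = after (q .neu₂)
          L₁ = F (q .neu₁ Vec.++ zeros)
          L₂ = F (q .neu₂ Vec.++ zeros)
          Fn = F (q .neg Vec.++ ones)
          lemma₁ : ∀ v₁ v₂ u l₁ l₂ → v₁ + v₂ + (suc u + 0) + (l₁ + l₂) ≡ (v₁ + l₁) + (v₂ + l₂) + suc u
          lemma₁ = solve-∀
          lemma₂ : ∀ u z n e → (u + z) + (n + e) + suc u ≡ 2 * u + z + suc n + e
          lemma₂ = solve-∀
          lemma₃ : ∀ u l₁ l₂ e₁ e₂ → u + l₂ + (l₁ + e₁) + e₂ ≡ u + (e₁ + e₂) + (l₁ + l₂)
          lemma₃ = solve-∀

        -- Only undecided gates can err, so the bound scales with `u` and not with the number `j` of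
        -- all gates.
        total-error : R * ∑ᴸ Ω err ≤ suc u * (2 * (α * W))
        total-error = begin
          R * ∑ᴸ Ω err
            ≡⟨ cong (R *_) (∑ᴸ-+ Ω err₁ err₂) ⟩
          R * (∑ᴸ Ω err₁ + ∑ᴸ Ω err₂)
            ≡⟨ *-distribˡ-+ R (∑ᴸ Ω err₁) _ ⟩
          R * ∑ᴸ Ω err₁ + R * ∑ᴸ Ω err₂
            ≤⟨ +-mono-≤
                 (swap _ λ i → undecided-error pos neu₁ (proj₁ ∘ fooling) zeros (thr i))
                 (swap _ λ i → undecided-error neu₂ neg (proj₂ ∘ fooling) ones (thr i)) ⟩
          u * (α * W) + u * (α * W)
            ≡⟨ lemma u (α * W) ⟩
          u * (2 * (α * W))
            ≤⟨ *-monoˡ-≤ (2 * (α * W)) (n≤1+n u) ⟩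
          suc u * (2 * (α * W))   ∎
          where
          open ≤-Reasoning
          lemma : ∀ u e → u * e + u * e ≡ u * (2 * e)
          lemma = solve-∀
          swap : (e : Quad k L → Fin j → ℕ) →
            (∀ i → R * ∑ᴸ Ω (λ q → e q i) ≤ viol (g i ones) (g i zeros) * (α * W)) →
            R * ∑ᴸ Ω (λ q → sum (e q)) ≤ u * (α * W)
          swap e e≤ = begin
            R * ∑ᴸ Ω (λ q → sum (e q))
              ≡⟨ cong (R *_) (∑ᴸ-sum-swap Ω e) ⟩
            R * sum (λ i → ∑ᴸ Ω (λ q → e q i))
              ≡⟨ *-comm R _ ⟩
            sum (λ i → ∑ᴸ Ω (λ q → e q i)) * R
              ≡⟨ sum-*ʳ (λ i → ∑ᴸ Ω (λ q → e q i)) R ⟨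
            sum (λ i → ∑ᴸ Ω (λ q → e q i) * R)
              ≤⟨ sum-mono (λ i → ≤-trans (≤-reflexive (*-comm (∑ᴸ Ω (λ q → e q i)) R)) (e≤ i)) ⟩
            sum (λ i → viol (g i ones) (g i zeros) * (α * W))
              ≡⟨ sum-*ʳ (λ i → viol (g i ones) (g i zeros)) (α * W) ⟩
            u * (α * W)   ∎

        -- Sums `potential-pays` over the quads with `w` equal to `suc u`. By `drop` and
        -- `total-error`, the price of a separation and the errors both scale with `suc u`, which
        -- cancels even if no gate is undecided.
        step : R * (c * ∑ᴸ Ω bad + ∑ᴸ Ω (λ q → Φ (after (q .neu₁)) + Φ (after (q .neu₂))))
          ≤ R * (2 * Φ u * W) + c * (2 * (α * W))
        step = *-cancelˡ-≤ (suc u) (begin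
          suc u * (R * (c * ∑ᴸ Ω bad + ∑ᴸ Ω Φ′))
            ≡⟨ lemma₁ (suc u) R _ ⟩
          R * (suc u * (c * ∑ᴸ Ω bad + ∑ᴸ Ω Φ′))
            ≡⟨ cong (λ s → R * (suc u * (s + ∑ᴸ Ω Φ′))) (∑ᴸ-* Ω c bad) ⟨
          R * (suc u * (∑ᴸ Ω (λ q → c * bad q) + ∑ᴸ Ω Φ′))
            ≡⟨ cong (λ s → R * (suc u * s)) (∑ᴸ-+ Ω (λ q → c * bad q) Φ′) ⟨
          R * (suc u * ∑ᴸ Ω (λ q → c * bad q + Φ′ q))
            ≡⟨ cong (R *_) (∑ᴸ-* Ω (suc u) (λ q → c * bad q + Φ′ q)) ⟨
          R * ∑ᴸ Ω (λ q → suc u * (c * bad q + Φ′ q))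
            ≤⟨ *-monoʳ-≤ R (∑ᴸ-mono Ω λ q →
                 potential-pays u≤B (n≤1+n u) (after≤u (q .neu₁)) (after≤u (q .neu₂)) (drop q)) ⟩
          R * ∑ᴸ Ω (λ q → suc u * (2 * Φ u) + c * err q)
            ≡⟨ cong (R *_) (∑ᴸ-+ Ω (λ _ → suc u * (2 * Φ u)) (λ q → c * err q)) ⟩
          R * (∑ᴸ Ω (λ _ → suc u * (2 * Φ u)) + ∑ᴸ Ω (λ q → c * err q))
            ≡⟨ cong₂ (λ a b → R * (a + b)) (∑ᴸ-const Ω (suc u * (2 * Φ u))) (∑ᴸ-* Ω c err) ⟩
          R * (suc u * (2 * Φ u) * W + c * ∑ᴸ Ω err)
            ≡⟨ lemma₂ R (suc u) (2 * Φ u) W c (∑ᴸ Ω err) ⟩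
          suc u * (R * (2 * Φ u * W)) + c * (R * ∑ᴸ Ω err)
            ≤⟨ +-monoʳ-≤ _ (*-monoʳ-≤ c total-error) ⟩
          suc u * (R * (2 * Φ u * W)) + c * (suc u * (2 * (α * W)))
            ≡⟨ lemma₃ (suc u) (R * (2 * Φ u * W)) c (2 * (α * W)) ⟩
          suc u * (R * (2 * Φ u * W) + c * (2 * (α * W)))   ∎)
          where
          open ≤-Reasoning
          Φ′ : Quad k L → ℕ
          Φ′ q = Φ (after (q .neu₁)) + Φ (after (q .neu₂))
          lemma₁ : ∀ w r s → w * (r * s) ≡ r * (w * s)
          lemma₁ = solve-∀
          lemma₂ : ∀ r w p W c e → r * (w * p * W + c * e) ≡ w * (r * (p * W)) + c * (r * e)
          lemma₂ = solve-∀
          lemma₃ : ∀ w a c b → w * a + c * (w * b) ≡ w * (a + c * b)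
          lemma₃ = solve-∀

      -- The potential drops telescope along the blocks: the initial potential pays for the
      -- separations at all positions, up to the errors made in each of the `T` blocks.
      chain-bound : ∀ T {j} (g : Fin j → Input k (T * L) → Bool) → j ≤ B → (∀ i → Thr ℓ (g i)) → ∀ t →
        let F = λ x → count λ i → g i x in
        c * R * ∑ᴸ (chain T) (λ p → viol (t ≤ᵇ F (p .accept)) (t ≤ᵇ F (p .reject)))
          ≤ prefixes T * (2 * (R * Φ (gap g)) + 2 * (c * α * T))
      chain-bound zero    g j≤B thr t rewrite *-zeroʳ (c * R) = z≤n
      chain-bound (suc T) {j} g j≤B thr t = begin
        c * R * ∑ᴸ (chain (suc T)) V
          ≡⟨ cong (c * R *_) (∑-chain T V) ⟩
        c * R * (2 * N * ∑ᴸ Ω bad + ∑ᴸ Ω I)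
          ≡⟨ trans (*-distribˡ-+ (c * R) _ _) (cong (c * R * (2 * N * ∑ᴸ Ω bad) +_) (sym (∑ᴸ-* Ω (c * R) I))) ⟩
        c * R * (2 * N * ∑ᴸ Ω bad) + ∑ᴸ Ω (λ q → c * R * I q)
          ≤⟨ +-monoʳ-≤ _ (∑ᴸ-mono Ω I-bound) ⟩
        c * R * (2 * N * ∑ᴸ Ω bad) + ∑ᴸ Ω (λ q → 2 * N * R * Φ′ q + 4 * N * (c * α * T))
          ≡⟨ cong (c * R * (2 * N * ∑ᴸ Ω bad) +_) (trans (∑ᴸ-+ Ω (λ q → 2 * N * R * Φ′ q) _)
               (cong₂ _+_ (∑ᴸ-* Ω (2 * N * R) Φ′) (∑ᴸ-const Ω (4 * N * (c * α * T))))) ⟩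
        c * R * (2 * N * ∑ᴸ Ω bad) + (2 * N * R * ∑ᴸ Ω Φ′ + 4 * N * (c * α * T) * W)
          ≡⟨ lemma₂ c R N (∑ᴸ Ω bad) (∑ᴸ Ω Φ′) (4 * N * (c * α * T) * W) ⟩
        2 * N * (R * (c * ∑ᴸ Ω bad + ∑ᴸ Ω Φ′)) + 4 * N * (c * α * T) * W
          ≤⟨ +-monoˡ-≤ _ (*-monoʳ-≤ (2 * N) step) ⟩
        2 * N * (R * (2 * Φ u * W) + c * (2 * (α * W))) + 4 * N * (c * α * T) * W
          ≡⟨ lemma₃ N R (Φ u) W c α T ⟩
        2 * W * N * (2 * (R * Φ u) + 2 * (c * α * suc T))   ∎
        where
        open ≤-Reasoning
        open Step {T * L} g j≤B thr t
        N = prefixes T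
        V : Pair k (suc T * L) → ℕ
        V p = viol (t ≤ᵇ F (p .accept)) (t ≤ᵇ F (p .reject))
        I Φ′ : Quad k L → ℕ
        I q = ∑ᴸ (chain T) (V ∘ prepend₁ q) + ∑ᴸ (chain T) (V ∘ prepend₂ q)
        Φ′ q = Φ (after (q .neu₁)) + Φ (after (q .neu₂))
        rec : ∀ z → c * R * ∑ᴸ (chain T) (λ p → viol (t ≤ᵇ F (z Vec.++ p .accept)) (t ≤ᵇ F (z Vec.++ p .reject)))
          ≤ N * (2 * (R * Φ (after z)) + 2 * (c * α * T))
        rec z = chain-bound T (λ i x → g i (z Vec.++ x)) j≤B (λ i → Thr-prefix ℓ z (thr i)) t
        I-bound : ∀ q → c * R * I q ≤ 2 * N * R * Φ′ q + 4 * N * (c * α * T)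
        I-bound q = begin
          c * R * I q
            ≡⟨ *-distribˡ-+ (c * R) (∑ᴸ (chain T) (V ∘ prepend₁ q)) _ ⟩
          c * R * ∑ᴸ (chain T) (V ∘ prepend₁ q) + c * R * ∑ᴸ (chain T) (V ∘ prepend₂ q)
            ≤⟨ +-mono-≤ (rec (q .neu₁)) (rec (q .neu₂)) ⟩
          N * (2 * (R * Φ (after (q .neu₁))) + 2 * (c * α * T)) + N * (2 * (R * Φ (after (q .neu₂))) + 2 * (c * α * T))
            ≡⟨ lemma₁ N R (Φ (after (q .neu₁))) (Φ (after (q .neu₂))) (c * α * T) ⟩
          2 * N * R * Φ′ q + 4 * N * (c * α * T)   ∎
          where
          lemma₁ : ∀ N R p₁ p₂ e → N * (2 * (R * p₁) + 2 * e) + N * (2 * (R * p₂) + 2 * e) ≡ 2 * N * R * (p₁ + p₂) + 4 * N * e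
          lemma₁ = solve-∀
        lemma₂ : ∀ c R N x p e → c * R * (2 * N * x) + (2 * N * R * p + e) ≡ 2 * N * (R * (c * x + p)) + e
        lemma₂ = solve-∀
        lemma₃ : ∀ N R p W c α T → 2 * N * (R * (2 * p * W) + c * (2 * (α * W))) + 4 * N * (c * α * T) * W ≡
          2 * W * N * (2 * (R * p) + 2 * (c * α * suc T))
        lemma₃ = solve-∀

      -- The length `T` is chosen so that the initial potential, at most `c * h`, accounts for the 1
      -- in the new error. The `2 * α` comes from the two comparisons `pos` with `neu₁` and `neu₂`
      -- with `neg`.
      chain-fooling : ∀ T → T ≡ 2 * (R * h) → PairFooling (suc ℓ) (1 + 2 * α) (chain T)
      chain-fooling T T≡ {f} (j , t , g , j≤B , thr , f≡) = *-cancelˡ-≤ c (begin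
        c * (R * ∑ᴸ (chain T) (λ p → viol (f (p .accept)) (f (p .reject))))
          ≡⟨ cong (λ s → c * (R * s)) (∑ᴸ-cong (chain T) λ p → cong₂ viol (f≡ (p .accept)) (f≡ (p .reject))) ⟩
        c * (R * ∑ᴸ (chain T) _)
          ≡⟨ *-assoc c R _ ⟨
        c * R * ∑ᴸ (chain T) _
          ≤⟨ chain-bound T g j≤B thr t ⟩
        prefixes T * (2 * (R * Φ (gap g)) + 2 * (c * α * T))
          ≤⟨ *-monoʳ-≤ (prefixes T) (+-monoˡ-≤ _ (*-monoʳ-≤ 2 (*-monoʳ-≤ R (Φ-bound (gap g))))) ⟩
        prefixes T * (2 * (R * (c * h)) + 2 * (c * α * T))
          ≡⟨ lemma₁ (prefixes T) R c h α T ⟩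
        prefixes T * (c * (2 * (R * h)) + 2 * (c * α * T))
          ≡⟨ cong (λ s → prefixes T * (c * s + 2 * (c * α * T))) T≡ ⟨
        prefixes T * (c * T + 2 * (c * α * T))
          ≡⟨ lemma₂ (prefixes T) c T α ⟩
        c * ((1 + 2 * α) * (T * prefixes T))
          ≡⟨ cong (λ s → c * ((1 + 2 * α) * s)) (∣chain∣ T) ⟨
        c * ((1 + 2 * α) * ∣ chain T ∣)   ∎)
        where
        open ≤-Reasoning
        lemma₁ : ∀ N R c h α T → N * (2 * (R * (c * h)) + 2 * (c * α * T)) ≡ N * (c * (2 * (R * h)) + 2 * (c * α * T))
        lemma₁ = solve-∀
        lemma₂ : ∀ N c T α → N * (c * T + 2 * (c * α * T)) ≡ c * ((1 + 2 * α) * (T * N))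
        lemma₂ = solve-∀

  -- Adding a row: from pairs to quads

  -- The rejected input has deficit `suc k`; adding `k` through the new row makes it neutral.
  rejectOffset : (p : Pair (suc k) L) → Σ[ r ∈ Vec Bool L ] rowVal r ≡ k
  rejectOffset {k} {L} p = binary L k (≤-trans (m≤n+m (suc k) (val (p .reject))) (≤-reflexive (p .val-reject)))

  -- With a leading 1 in the new row, the deficit of an input falls by the value of the rest
  -- of that row; with a leading 0 and the rest of it all ones, the deficit rises by 1.
  widen : Pair (suc k) L → Quad (suc (suc k)) (suc L)
  widen p .pos  = (true ∷ Vec.replicate _ false) ∷ addRow (Vec.replicate _ false) (p .accept)
  widen p .neu₁ = (true ∷ Vec.replicate _ false) ∷ addRow (proj₁ (rejectOffset p)) (p .reject)
  widen p .neu₂ = Vec.replicate _ false ∷ addRow (Vec.replicate _ true) (p .accept)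
  widen p .neg  = Vec.replicate _ false ∷ addRow (Vec.replicate _ true) (p .reject)
  widen {k} {L} p .val-pos
    rewrite weight-false (suc k) | val-addRow (Vec.replicate L false) (p .accept)
          | rowVal-false L | p .val-accept = lemma (2 ^ L)
    where
    lemma : ∀ l → l * 1 + l ≡ 2 * l
    lemma = solve-∀
  widen {k} {L} p .val-neu₁
    rewrite weight-false (suc k) | val-addRow (proj₁ (rejectOffset p)) (p .reject)
          | proj₂ (rejectOffset p) = trans (lemma (2 ^ L) k (val (p .reject)))
            (cong (2 ^ L +_) (trans (p .val-reject) (sym (+-identityʳ (2 ^ L)))))
    where
    lemma : ∀ l k v → suc (l * 1 + (k + v)) ≡ l + (v + suc k)
    lemma = solve-∀
  widen {k} {L} p .val-neu₂
    rewrite weight-false (suc (suc k)) | val-addRow (Vec.replicate L true) (p .accept)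
          | *-zeroʳ (2 ^ L) | p .val-accept | +-identityʳ (2 ^ L) = cong (_+ 2 ^ L) (rowVal-true L)
  widen {k} {L} p .val-neg
    rewrite weight-false (suc (suc k)) | val-addRow (Vec.replicate L true) (p .reject)
          | *-zeroʳ (2 ^ L) | +-identityʳ (2 ^ L) =
            trans (lemma (rowVal (Vec.replicate L true)) (val (p .reject)) k)
              (cong₂ _+_ (rowVal-true L) (p .val-reject))
    where
    lemma : ∀ r v k → r + v + suc (suc k) ≡ suc r + (v + suc k)
    lemma = solve-∀

  -- With the new row fixed, f is a formula of the same depth on the old rows. `neu₂` and `neg`
  -- share their new row. The one of `neu₁` is lowered to that of `pos`, which by monotonicity can
  -- only add errors.
  widen-fooling : ∀ ℓ α (ps : List (Pair (suc k) L)) → PairFooling ℓ α ps → QuadFooling ℓ α (map widen ps)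
  widen-fooling {k} {L} ℓ α ps fooling {f} thr =
    transfer pos neu₁ (true ∷ Vec.replicate _ false) (Vec.replicate _ false)
      (λ p → Bool.≤-refl)
      (λ p → Thr-mono ℓ thr (Pointwise.refl Bool.≤-refl ∷ addRow-⊑ (rows (proj₁ (rejectOffset p))) (p .reject))) ,
    transfer neu₂ neg (Vec.replicate _ false) (Vec.replicate _ true)
      (λ p → Bool.≤-refl) (λ p → Bool.≤-refl)
    where
    rows : ∀ {n} (r : Vec Bool n) → Pointwise Bool._≤_ (Vec.replicate n false) r
    rows []      = []
    rows (b ∷ r) = Bool.≤-minimum b ∷ rows r
    transfer : (l r : Quad (suc (suc k)) (suc L) → Input (suc (suc k)) (suc L))
      (c : Vec Bool (suc (suc k))) (row : Vec Bool L) →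
      (∀ p → f (l (widen p)) Bool.≤ f (c ∷ addRow row (p .accept))) →
      (∀ p → f (c ∷ addRow row (p .reject)) Bool.≤ f (r (widen p))) →
      Fools α (map widen ps) l r f
    transfer l r c row l≤ ≤r = begin
      R * ∑ᴸ (map widen ps) (λ q → viol (f (l q)) (f (r q)))
        ≡⟨ cong (R *_) (∑ᴸ-map widen ps _) ⟩
      R * ∑ᴸ ps (λ p → viol (f (l (widen p))) (f (r (widen p))))
        ≤⟨ *-monoʳ-≤ R (∑ᴸ-mono ps λ p → viol-mono _ _ _ _ (l≤ p) (≤r p)) ⟩
      R * ∑ᴸ ps (λ p → viol (f (c ∷ addRow row (p .accept))) (f (c ∷ addRow row (p .reject))))
        ≤⟨ fooling (Threshold-∘ (λ x → c ∷ addRow row x) (addRow-literal c row) ℓ thr) ⟩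
      α * ∣ ps ∣
        ≡⟨ cong (α *_) (∑ᴸ-map widen ps _) ⟨
      α * ∣ map widen ps ∣   ∎
      where open ≤-Reasoning

  -- The two-row quads fooling single gates

  Neutral : ℕ → Set
  Neutral T = Σ[ z ∈ Input 2 T ] suc (val z) ≡ 2 ^ T

  column : Bool → Vec Bool 2
  column b = b ∷ not b ∷ []

  weight-column : ∀ b → weight (column b) ≡ 1
  weight-column false = refl
  weight-column true  = refl

  val-column∷ : ∀ T {v} → suc v ≡ 2 ^ T → suc (2 ^ T * 1 + v) ≡ 2 ^ suc T
  val-column∷ T {v} eq = trans (lemma (2 ^ T) v) (cong (λ a → 2 ^ T + (a + 0)) eq)
    where
    lemma : ∀ p v → suc (p * 1 + v) ≡ p + (suc v + 0)
    lemma = solve-∀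

  column∷ : Bool → ∀ {T} → Neutral T → Neutral (suc T)
  column∷ b {T} (z , eq) = column b ∷ z ,
    trans (cong (λ w → suc (2 ^ T * w + val z)) (weight-column b)) (val-column∷ T eq)

  neutrals : ∀ T → List (Neutral T)
  neutrals zero    = ([] , refl) ∷ []
  neutrals (suc T) = map (column∷ true) (neutrals T) ++ map (column∷ false) (neutrals T)

  ∣neutrals∣ : ∀ T → ∣ neutrals T ∣ ≡ 2 ^ T
  ∣neutrals∣ zero    = refl
  ∣neutrals∣ (suc T) rewrite ∑ᴸ-++ (map (column∷ true) (neutrals T)) (map (column∷ false) (neutrals T)) (λ _ → 1)
    | ∑ᴸ-map (column∷ true) (neutrals T) (λ _ → 1) | ∑ᴸ-map (column∷ false) (neutrals T) (λ _ → 1)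
    | ∣neutrals∣ T = cong (2 ^ T +_) (sym (+-identityʳ (2 ^ T)))

  diverge : Bool → ∀ {T} → Neutral T → Quad 2 (suc T)
  diverge b z .pos  = (true ∷ true ∷ []) ∷ zeros
  diverge b z .neu₁ = proj₁ (column∷ b z)
  diverge b z .neu₂ = proj₁ (column∷ b z)
  diverge b z .neg  = (false ∷ false ∷ []) ∷ ones
  diverge b {T} z .val-pos rewrite val-zeros 2 T = lemma (2 ^ T)
    where
    lemma : ∀ p → p * 2 + 0 ≡ 2 * p
    lemma = solve-∀
  diverge b z .val-neu₁ = proj₂ (column∷ b z)
  diverge b z .val-neu₂ = proj₂ (column∷ b z)
  diverge b {T} z .val-neg rewrite *-zeroʳ (2 ^ T) = val-ones 2 T

  column∷∷ : Bool → ∀ {T} → Quad 2 T → Quad 2 (suc T)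
  column∷∷ b q .pos  = column b ∷ q .pos
  column∷∷ b q .neu₁ = column b ∷ q .neu₁
  column∷∷ b q .neu₂ = column b ∷ q .neu₂
  column∷∷ b q .neg  = column b ∷ q .neg
  column∷∷ b {T} q .val-pos rewrite weight-column b | q .val-pos = lemma (2 ^ T)
    where
    lemma : ∀ p → p * 1 + p ≡ 2 * p
    lemma = solve-∀
  column∷∷ b q .val-neu₁ = proj₂ (column∷ b (q .neu₁ , q .val-neu₁))
  column∷∷ b q .val-neu₂ = proj₂ (column∷ b (q .neu₂ , q .val-neu₂))
  column∷∷ b {T} q .val-neg rewrite weight-column b = trans (+-assoc (2 ^ T * 1) _ 2)
    (trans (cong (2 ^ T * 1 +_) (q .val-neg)) (lemma (2 ^ T)))
    where
    lemma : ∀ p → p * 1 + p ≡ 2 * p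
    lemma = solve-∀

  -- A quad diverges at a uniform position after a random neutral prefix; neu₁ and neu₂ are
  -- both the continuation of this prefix to a random neutral input.
  base : ∀ T → List (Quad 2 T)
  base zero    = []
  base (suc T) = (map (diverge true)  (neutrals T) ++ map (column∷∷ true)  (base T)) ++
                 (map (diverge false) (neutrals T) ++ map (column∷∷ false) (base T))

  ∑-base : ∀ T (f : Quad 2 (suc T) → ℕ) → ∑ᴸ (base (suc T)) f ≡
    (∑ᴸ (neutrals T) (f ∘ diverge true)  + ∑ᴸ (base T) (f ∘ column∷∷ true)) +
    (∑ᴸ (neutrals T) (f ∘ diverge false) + ∑ᴸ (base T) (f ∘ column∷∷ false))
  ∑-base T f = trans (∑ᴸ-++ (map (diverge true) (neutrals T) ++ map (column∷∷ true) (base T)) _ f)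
    (cong₂ _+_ (half true) (half false))
    where
    half : ∀ b → ∑ᴸ (map (diverge b) (neutrals T) ++ map (column∷∷ b) (base T)) f ≡
      ∑ᴸ (neutrals T) (f ∘ diverge b) + ∑ᴸ (base T) (f ∘ column∷∷ b)
    half b = trans (∑ᴸ-++ (map (diverge b) (neutrals T)) _ f)
      (cong₂ _+_ (∑ᴸ-map (diverge b) (neutrals T) f) (∑ᴸ-map (column∷∷ b) (base T) f))

  ∣base∣ : ∀ T → ∣ base T ∣ ≡ T * 2 ^ T
  ∣base∣ zero = refl
  ∣base∣ (suc T) rewrite ∑-base T (λ _ → 1) | ∣neutrals∣ T | ∣base∣ T = lemma T (2 ^ T)
    where
    lemma : ∀ T N → (N + T * N) + (N + T * N) ≡ suc T * (2 * N)
    lemma = solve-∀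

  Literals : ℕ → ℕ → Set
  Literals j T = Σ[ g ∈ (Fin j → Input 2 T → Bool) ] (∀ i → Thr 0 (g i))

  infix 9 _⟨_⟩
  _⟨_⟩ : ∀ {j T} → Literals j T → Input 2 T → ℕ
  (g , _) ⟨ x ⟩ = count λ i → g i x

  fix : ∀ {j T} → Bool → Literals j (suc T) → Literals j T
  fix b (g , lit) = (λ i x → g i (column b ∷ x)) , λ i → Thr-prefix 0 (column b ∷ []) (lit i)

  ⟨⟩-mono : ∀ {j T} (g : Literals j T) {x y} → x ⊑ y → g ⟨ x ⟩ ≤ g ⟨ y ⟩
  ⟨⟩-mono (g , lit) x⊑y = sum-mono λ i → bit-mono (Thr-mono 0 (lit i) x⊑y)

  ⟨⟩≤ : ∀ {j T} (g : Literals j T) x → g ⟨ x ⟩ ≤ j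
  ⟨⟩≤ g x = count≤ _

  -- A single gate is additive in the input bits, so the two neutral columns together
  -- contribute as much as the columns 11 and 00.
  ⟨⟩-additive : ∀ {j T} (g : Literals j (suc T)) x →
    g ⟨ (true ∷ true ∷ []) ∷ x ⟩ + g ⟨ (false ∷ false ∷ []) ∷ x ⟩ ≡
    fix true g ⟨ x ⟩ + fix false g ⟨ x ⟩
  ⟨⟩-additive (g , lit) x = trans (sym (∑-distrib-+ (λ i → bit (g i (_ ∷ x))) _))
    (trans (sum-cong-≗ λ i → literal (lit i)) (∑-distrib-+ (λ i → bit (g i (_ ∷ x))) _))
    where
    literal : ∀ {f} → Literal at f →
      bit (f ((true ∷ true ∷ []) ∷ x)) + bit (f ((false ∷ false ∷ []) ∷ x)) ≡
      bit (f (column true ∷ x)) + bit (f (column false ∷ x))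
    literal (constant b f≡b)
      rewrite f≡b ((true ∷ true ∷ []) ∷ x) | f≡b ((false ∷ false ∷ []) ∷ x)
            | f≡b (column true ∷ x) | f≡b (column false ∷ x) = refl
    literal (coordinate v f≡v)
      rewrite f≡v ((true ∷ true ∷ []) ∷ x) | f≡v ((false ∷ false ∷ []) ∷ x)
            | f≡v (column true ∷ x) | f≡v (column false ∷ x) with v
    ... | zero     , zero  = refl
    ... | suc zero , zero  = refl
    ... | _        , suc _ = refl

  -- The error-free case of `potential-pays`: where there is something to pay, the two branches
  -- halve `D` on average, and `D` is positive and cancels.
  branch-pays : ∀ {D v₁ v₂ X} → D ≤ B → v₁ ≤ D → v₂ ≤ D →
    X ≡ 0 ⊎ (X ≡ 1 × 1 ≤ D × v₁ + v₂ ≤ D) →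
    c * X + (Φ v₁ + Φ v₂) ≤ 2 * Φ D
  branch-pays {D} {v₁} {v₂} D≤B v₁≤D v₂≤D (inj₁ refl) rewrite *-zeroʳ c | +-identityʳ (Φ D) =
    +-mono-≤ (*-monoʳ-≤ 2 (Ψ-mono m v₁≤D)) (*-monoʳ-≤ 2 (Ψ-mono m v₂≤D))
  branch-pays {suc D} {v₁} {v₂} D≤B v₁≤D v₂≤D (inj₂ (refl , _ , v₁+v₂≤D)) =
    *-cancelˡ-≤ (suc D) (≤-trans
      (potential-pays {E = 0} D≤B ≤-refl v₁≤D v₂≤D
        (≤-trans (+-monoˡ-≤ (1 * suc D) v₁+v₂≤D) (≤-reflexive (lemma (suc D)))))
      (≤-reflexive (trans (cong (suc D * (2 * Φ (suc D)) +_) (*-zeroʳ c)) (+-identityʳ _))))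
    where
    lemma : ∀ D → D + 1 * D ≡ 2 * D + 0
    lemma = solve-∀

  -- The potential argument common to both comparisons: `X` bounds the error if the inputs diverge
  -- at the current column, and it is paid for by the expected drop of `Φ` when this column is fixed
  -- to 10 or 01.
  base-bound : ∀ {j} (bad : ∀ {T} → Literals j T → Quad 2 T → ℕ)
    (D : ∀ {T} → Literals j T → ℕ) (X : ∀ {T} → Literals j (suc T) → ℕ) →
    (∀ {T} (g : Literals j (suc T)) b z → bad g (diverge b z) ≤ X g) →
    (∀ {T} (g : Literals j (suc T)) b q → bad g (column∷∷ b q) ≤ bad (fix b g) q) →
    (∀ {T} (g : Literals j (suc T)) → c * X g + (Φ (D (fix true g)) + Φ (D (fix false g))) ≤ 2 * Φ (D g)) →
    ∀ T (g : Literals j T) → c * ∑ᴸ (base T) (bad g) ≤ 2 ^ T * (2 * Φ (D g))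
  base-bound bad D X diverge≤ fix≤ pays zero g rewrite *-zeroʳ c = z≤n
  base-bound bad D X diverge≤ fix≤ pays (suc T) g = begin
    c * ∑ᴸ (base (suc T)) (bad g)
      ≡⟨ cong (c *_) (∑-base T (bad g)) ⟩
    c * ((now true + later true) + (now false + later false))
      ≡⟨ lemma₁ c (now true) (later true) (now false) (later false) ⟩
    c * (now true + now false) + (c * later true + c * later false)
      ≤⟨ +-mono-≤ (*-monoʳ-≤ c (+-mono-≤ (now≤ true) (now≤ false))) (+-mono-≤ (later≤ true) (later≤ false)) ⟩
    c * (X g * 2 ^ T + X g * 2 ^ T) + (2 ^ T * (2 * Φ (D (fix true g))) + 2 ^ T * (2 * Φ (D (fix false g))))
      ≡⟨ lemma₂ c (X g) (2 ^ T) (Φ (D (fix true g))) (Φ (D (fix false g))) ⟩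
    2 * 2 ^ T * (c * X g + (Φ (D (fix true g)) + Φ (D (fix false g))))
      ≤⟨ *-monoʳ-≤ (2 * 2 ^ T) (pays g) ⟩
    2 * 2 ^ T * (2 * Φ (D g))   ∎
    where
    open ≤-Reasoning
    now later : Bool → ℕ
    now b = ∑ᴸ (neutrals T) (bad g ∘ diverge b)
    later b = ∑ᴸ (base T) (bad g ∘ column∷∷ b)
    now≤ : ∀ b → now b ≤ X g * 2 ^ T
    now≤ b = subst (λ n → now b ≤ X g * n) (∣neutrals∣ T) (∑ᴸ-≤-const (neutrals T) (X g) (diverge≤ g b))
    later≤ : ∀ b → c * later b ≤ 2 ^ T * (2 * Φ (D (fix b g)))
    later≤ b = ≤-trans (*-monoʳ-≤ c (∑ᴸ-mono (base T) (fix≤ g b)))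
      (base-bound bad D X diverge≤ fix≤ pays T (fix b g))
    lemma₁ : ∀ c a b d e → c * ((a + b) + (d + e)) ≡ c * (a + d) + (c * b + c * e)
    lemma₁ = solve-∀
    lemma₂ : ∀ c x n p q → c * (x * n + x * n) + (n * (2 * p) + n * (2 * q)) ≡ 2 * n * (c * x + (p + q))
    lemma₂ = solve-∀

  -- If one truncated difference vanishes, monotonicity bounds the other; otherwise no truncation
  -- occurs and the sums can be compared.
  ∸-superadditive : ∀ {p q s t} → p ≤ s → q ≤ s → p + q ≤ s + t → (p ∸ t) + (q ∸ t) ≤ s ∸ t
  ∸-superadditive {p} {q} {s} {t} p≤s q≤s p+q≤s+t with ≤-total p t | ≤-total q t
  ... | inj₁ p≤t | _ rewrite m≤n⇒m∸n≡0 p≤t = ∸-monoˡ-≤ t q≤s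
  ... | inj₂ t≤p | inj₁ q≤t rewrite m≤n⇒m∸n≡0 q≤t | +-identityʳ (p ∸ t) = ∸-monoˡ-≤ t p≤s
  ... | inj₂ t≤p | inj₂ t≤q = +-cancelʳ-≤ (t + t) _ _ (begin
    (p ∸ t) + (q ∸ t) + (t + t)     ≡⟨ lemma (p ∸ t) (q ∸ t) t ⟩
    (p ∸ t + t) + (q ∸ t + t)       ≡⟨ cong₂ _+_ (m∸n+n≡m t≤p) (m∸n+n≡m t≤q) ⟩
    p + q                           ≤⟨ p+q≤s+t ⟩
    s + t                           ≡⟨ cong (_+ t) (m∸n+n≡m (≤-trans t≤p p≤s)) ⟨
    s ∸ t + t + t                   ≡⟨ +-assoc (s ∸ t) t t ⟩
    s ∸ t + (t + t)                 ∎)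
    where
    open ≤-Reasoning
    lemma : ∀ a b t → a + b + (t + t) ≡ (a + t) + (b + t)
    lemma = solve-∀

  ∸-subadditive : ∀ {a b z t} → z ≤ a → z ≤ b → t + z ≤ a + b → (t ∸ a) + (t ∸ b) ≤ t ∸ z
  ∸-subadditive {a} {b} {z} {t} z≤a z≤b t+z≤a+b with ≤-total t a | ≤-total t b
  ... | inj₁ t≤a | _ rewrite m≤n⇒m∸n≡0 t≤a = ∸-monoʳ-≤ t z≤b
  ... | inj₂ a≤t | inj₁ t≤b rewrite m≤n⇒m∸n≡0 t≤b | +-identityʳ (t ∸ a) = ∸-monoʳ-≤ t z≤a
  ... | inj₂ a≤t | inj₂ b≤t = +-cancelʳ-≤ (t + z) _ _ (begin
    (t ∸ a) + (t ∸ b) + (t + z)     ≤⟨ +-monoʳ-≤ ((t ∸ a) + (t ∸ b)) t+z≤a+b ⟩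
    (t ∸ a) + (t ∸ b) + (a + b)     ≡⟨ lemma (t ∸ a) (t ∸ b) a b ⟩
    (t ∸ a + a) + (t ∸ b + b)       ≡⟨ cong₂ _+_ (m∸n+n≡m a≤t) (m∸n+n≡m b≤t) ⟩
    t + t                           ≡⟨ cong (_+ t) (m∸n+n≡m (≤-trans z≤a a≤t)) ⟨
    t ∸ z + z + t                   ≡⟨ lemma′ (t ∸ z) z t ⟩
    t ∸ z + (t + z)                 ∎)
    where
    open ≤-Reasoning
    lemma : ∀ p q a b → p + q + (a + b) ≡ (p + a) + (q + b)
    lemma = solve-∀
    lemma′ : ∀ p z t → p + z + t ≡ p + (t + z)
    lemma′ = solve-∀

  -- The potential measures the shortfall from `t` when zeros follow. If 11 followed by zeros
  -- reaches `t`, additivity makes the shortfalls after 10 and 01 sum to at most the one after 00.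
  base-bound₁ : ∀ {j t} → t ≤ B → ∀ T (g : Literals j T) →
    c * ∑ᴸ (base T) (λ q → viol (t ≤ᵇ g ⟨ q .pos ⟩) (t ≤ᵇ g ⟨ q .neu₁ ⟩)) ≤ 2 ^ T * (2 * Φ (t ∸ g ⟨ zeros ⟩))
  base-bound₁ {j} {t} t≤B = base-bound _ (λ g → t ∸ g ⟨ zeros ⟩)
    (λ g → viol (t ≤ᵇ g ⟨ (true ∷ true ∷ []) ∷ zeros ⟩) (t ≤ᵇ g ⟨ zeros ⟩))
    (λ g b z → viol-mono _ _ _ _ Bool.≤-refl (≤ᵇ-mono t (⟨⟩-mono g (zeros-⊑ _))))
    (λ g b q → ≤-refl)
    (λ g → branch-pays (≤-trans (m∸n≤m t (g ⟨ zeros ⟩)) t≤B)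
      (∸-monoʳ-≤ t (⟨⟩-mono g (zeros-⊑ _))) (∸-monoʳ-≤ t (⟨⟩-mono g (zeros-⊑ _))) (cost g))
    where
    cost : ∀ {T} (g : Literals j (suc T)) →
      let X = viol (t ≤ᵇ g ⟨ (true ∷ true ∷ []) ∷ zeros ⟩) (t ≤ᵇ g ⟨ zeros ⟩) in
      X ≡ 0 ⊎ (X ≡ 1 × 1 ≤ t ∸ g ⟨ zeros ⟩ ×
        (t ∸ fix true g ⟨ zeros ⟩) + (t ∸ fix false g ⟨ zeros ⟩) ≤ t ∸ g ⟨ zeros ⟩)
    cost g with viol-threshold t (g ⟨ (true ∷ true ∷ []) ∷ zeros ⟩) (g ⟨ zeros ⟩)
    ... | inj₁ X≡0 = inj₁ X≡0
    ... | inj₂ (X≡1 , t≤F₁₁ , F₀₀<t) = inj₂ (X≡1 , m<n⇒0<n∸m F₀₀<t ,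
      ∸-subadditive (⟨⟩-mono g (zeros-⊑ _)) (⟨⟩-mono g (zeros-⊑ _))
        (≤-trans (+-monoˡ-≤ (g ⟨ zeros ⟩) t≤F₁₁) (≤-reflexive (⟨⟩-additive g zeros))))

  -- Dual to `base-bound₁`, with the surplus over `t` when ones follow. The `suc` makes the surplus
  -- positive when `t` is met exactly.
  base-bound₂ : ∀ {j t} → 1 ≤ t → j ≤ B → ∀ T (g : Literals j T) →
    c * ∑ᴸ (base T) (λ q → viol (t ≤ᵇ g ⟨ q .neu₂ ⟩) (t ≤ᵇ g ⟨ q .neg ⟩)) ≤ 2 ^ T * (2 * Φ (suc (g ⟨ ones ⟩) ∸ t))
  base-bound₂ {j} {t} 1≤t j≤B = base-bound _ (λ g → suc (g ⟨ ones ⟩) ∸ t)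
    (λ g → viol (t ≤ᵇ g ⟨ ones ⟩) (t ≤ᵇ g ⟨ (false ∷ false ∷ []) ∷ ones ⟩))
    (λ g b z → viol-mono _ _ _ _ (≤ᵇ-mono t (⟨⟩-mono g (⊑-ones _))) Bool.≤-refl)
    (λ g b q → ≤-refl)
    (λ g → branch-pays (≤-trans (∸-monoʳ-≤ (suc (g ⟨ ones ⟩)) 1≤t) (≤-trans (⟨⟩≤ g ones) j≤B))
      (∸-monoˡ-≤ t (s≤s (⟨⟩-mono g (⊑-ones _)))) (∸-monoˡ-≤ t (s≤s (⟨⟩-mono g (⊑-ones _)))) (cost g))
    where
    cost : ∀ {T} (g : Literals j (suc T)) →
      let X = viol (t ≤ᵇ g ⟨ ones ⟩) (t ≤ᵇ g ⟨ (false ∷ false ∷ []) ∷ ones ⟩) in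
      X ≡ 0 ⊎ (X ≡ 1 × 1 ≤ suc (g ⟨ ones ⟩) ∸ t ×
        (suc (fix true g ⟨ ones ⟩) ∸ t) + (suc (fix false g ⟨ ones ⟩) ∸ t) ≤ suc (g ⟨ ones ⟩) ∸ t)
    cost g with viol-threshold t (g ⟨ ones ⟩) (g ⟨ (false ∷ false ∷ []) ∷ ones ⟩)
    ... | inj₁ X≡0 = inj₁ X≡0
    ... | inj₂ (X≡1 , t≤F₁₁ , F₀₀<t) = inj₂ (X≡1 , m<n⇒0<n∸m (s≤s t≤F₁₁) ,
      ∸-superadditive (s≤s (⟨⟩-mono g (⊑-ones _))) (s≤s (⟨⟩-mono g (⊑-ones _))) (begin
        suc (fix true g ⟨ ones ⟩) + suc (fix false g ⟨ ones ⟩)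
          ≡⟨ cong suc (trans (+-suc _ _) (cong suc (sym (⟨⟩-additive g ones)))) ⟩
        suc (suc (g ⟨ ones ⟩ + g ⟨ (false ∷ false ∷ []) ∷ ones ⟩))
          ≡⟨ cong suc (+-suc (g ⟨ ones ⟩) _) ⟨
        suc (g ⟨ ones ⟩ + suc (g ⟨ (false ∷ false ∷ []) ∷ ones ⟩))
          ≤⟨ s≤s (+-monoʳ-≤ (g ⟨ ones ⟩) F₀₀<t) ⟩
        suc (g ⟨ ones ⟩) + t   ∎))
      where open ≤-Reasoning

  -- The potential bounds the expected number of bad positions independently of `T`, so taking `T`
  -- positions brings the error probability down to 1 / R.
  base-fooling : ∀ T → T ≡ 2 * (R * h) → QuadFooling 1 1 (base T)
  base-fooling T T≡ {f} (j , t , g , j≤B , lit , f≡) = fools pos neu₁ bound₁ , fools neu₂ neg bound₂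
    where
    open ≤-Reasoning
    gs : Literals j T
    gs = g , lit
    fools : (l r : Quad 2 T → Input 2 T) →
      (∑ᴸ (base T) (λ q → viol (t ≤ᵇ gs ⟨ l q ⟩) (t ≤ᵇ gs ⟨ r q ⟩)) ≡ 0 ⊎
        ∃ λ D → c * ∑ᴸ (base T) (λ q → viol (t ≤ᵇ gs ⟨ l q ⟩) (t ≤ᵇ gs ⟨ r q ⟩)) ≤ 2 ^ T * (2 * Φ D)) →
      Fools 1 (base T) l r f
    fools l r bound rewrite ∑ᴸ-cong (base T) (λ q → cong₂ viol (f≡ (l q)) (f≡ (r q))) with bound
    ... | inj₁ eq rewrite eq | *-zeroʳ R = z≤n
    ... | inj₂ (D , ≤D) = *-cancelˡ-≤ c (begin
      c * (R * S)                     ≡⟨ lemma₁ c R S ⟩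
      R * (c * S)                     ≤⟨ *-monoʳ-≤ R ≤D ⟩
      R * (2 ^ T * (2 * Φ D))         ≤⟨ *-monoʳ-≤ R (*-monoʳ-≤ (2 ^ T) (*-monoʳ-≤ 2 (Φ-bound D))) ⟩
      R * (2 ^ T * (2 * (c * h)))     ≡⟨ lemma₂ c R (2 ^ T) h ⟩
      c * (1 * (2 * (R * h) * 2 ^ T)) ≡⟨ cong (λ s → c * (1 * (s * 2 ^ T))) T≡ ⟨
      c * (1 * (T * 2 ^ T))           ≡⟨ cong (λ s → c * (1 * s)) (∣base∣ T) ⟨
      c * (1 * ∣ base T ∣)            ∎)
      where
      S = ∑ᴸ (base T) (λ q → viol (t ≤ᵇ gs ⟨ l q ⟩) (t ≤ᵇ gs ⟨ r q ⟩))
      lemma₁ : ∀ c R S → c * (R * S) ≡ R * (c * S)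
      lemma₁ = solve-∀
      lemma₂ : ∀ c R N h → R * (N * (2 * (c * h))) ≡ c * (1 * (2 * (R * h) * N))
      lemma₂ = solve-∀
    bound₁ : ∑ᴸ (base T) (λ q → viol (t ≤ᵇ gs ⟨ q .pos ⟩) (t ≤ᵇ gs ⟨ q .neu₁ ⟩)) ≡ 0 ⊎ _
    -- A threshold above `B` exceeds the in-degree, so the gate never accepts; otherwise the
    -- shortfall is at most `B`, as the potential bound requires.
    bound₁ with t ≤? B
    ... | yes t≤B = inj₂ (_ , base-bound₁ t≤B T gs)
    ... | no t≰B  = inj₁ (∑ᴸ-zero (base T) never)
      where
      never : ∀ q → viol (t ≤ᵇ gs ⟨ q .pos ⟩) (t ≤ᵇ gs ⟨ q .neu₁ ⟩) ≡ 0
      never q with viol-threshold t (gs ⟨ q .pos ⟩) (gs ⟨ q .neu₁ ⟩)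
      ... | inj₁ eq            = eq
      ... | inj₂ (_ , t≤F , _) = contradiction (≤-trans t≤F (≤-trans (⟨⟩≤ gs (q .pos)) j≤B)) t≰B
    bound₂ : ∑ᴸ (base T) (λ q → viol (t ≤ᵇ gs ⟨ q .neu₂ ⟩) (t ≤ᵇ gs ⟨ q .neg ⟩)) ≡ 0 ⊎ _
    -- With threshold 0 the gate never rejects; otherwise the surplus is at most the in-degree.
    bound₂ with 1 ≤? t
    ... | yes 1≤t = inj₂ (_ , base-bound₂ 1≤t j≤B T gs)
    ... | no 1≰t  = inj₁ (∑ᴸ-zero (base T) never)
      where
      never : ∀ q → viol (t ≤ᵇ gs ⟨ q .neu₂ ⟩) (t ≤ᵇ gs ⟨ q .neg ⟩) ≡ 0
      never q with viol-threshold t (gs ⟨ q .neu₂ ⟩) (gs ⟨ q .neg ⟩)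
      ... | inj₁ eq            = eq
      ... | inj₂ (_ , _ , F<t) = contradiction (≤-trans (s≤s z≤n) F<t) 1≰t

  -- Induction on the depth

  module Levels (1≤R : 1 ≤ R) where

    T : ℕ
    T = 2 * (R * h)

    1≤T : 1 ≤ T
    1≤T = *-mono-≤ {1} {2} (s≤s z≤n) (*-mono-≤ 1≤R (*-mono-≤ {1} {2} (s≤s z≤n) (s≤s z≤n)))

    ^-≥1 : ∀ {a} n → 1 ≤ a → 1 ≤ a ^ n
    ^-≥1 zero    1≤a = ≤-refl
    ^-≥1 (suc n) 1≤a = *-mono-≤ 1≤a (^-≥1 n 1≤a)

    1≤∣chain∣ : (Ω : List (Quad k L)) → 1 ≤ ∣ Ω ∣ → 1 ≤ ∣ Chain.chain Ω T ∣
    1≤∣chain∣ Ω 1≤W = subst (1 ≤_) (sym (Chain.∣chain∣ Ω T))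
      (*-mono-≤ 1≤T (^-≥1 T (*-mono-≤ {1} {2} (s≤s z≤n) 1≤W)))

    -- The error recursion from α to 1 + 2 α, starting with 3 at depth 2, gives 2^k - 1. `short`
    -- bounds `suc length` because `widen` adds a column.
    record Level (k : ℕ) : Set where
      field
        length   : ℕ
        pairs    : List (Pair k length)
        α        : ℕ
        fooling  : PairFooling k α pairs
        nonempty : 1 ≤ ∣ pairs ∣
        α<2^k    : suc α ≡ 2 ^ k
        short    : suc length ≤ (2 * T) ^ k

    level : ∀ i → Level (2 + i)
    level zero = record
      { length   = T * T
      ; pairs    = Chain.chain (base T) T
      ; α        = 3
      ; fooling  = Chain.chain-fooling (base T) {ℓ = 1} {α = 1} (base-fooling T refl) T refl
      ; nonempty = 1≤∣chain∣ (base T) (subst (1 ≤_) (sym (∣base∣ T)) (*-mono-≤ 1≤T (m^n>0 2 T)))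
      ; α<2^k    = refl
      ; short    = ≤-trans (+-monoˡ-≤ (T * T) (*-mono-≤ 1≤T 1≤T)) (≤-trans (m≤m+n _ (2 * (T * T))) (≤-reflexive (lemma T)))
      }
      where
      lemma : ∀ T → T * T + T * T + 2 * (T * T) ≡ 2 * T * (2 * T * 1)
      lemma = solve-∀
    level (suc i) = record
      { length   = T * suc length
      ; pairs    = Chain.chain (map widen pairs) T
      ; α        = 1 + 2 * α
      ; fooling  = Chain.chain-fooling (map widen pairs) {ℓ = 2 + i} {α = α} (widen-fooling (2 + i) α pairs fooling) T refl
      ; nonempty = 1≤∣chain∣ (map widen pairs) (subst (1 ≤_) (sym (∑ᴸ-map widen pairs (λ _ → 1))) nonempty)
      ; α<2^k    = trans (lemma α) (cong (2 *_) α<2^k)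
      ; short    = ≤-trans (+-mono-≤ (*-mono-≤ 1≤T (≤-trans (s≤s z≤n) short)) (*-monoʳ-≤ T short))
                     (≤-reflexive (lemma′ T ((2 * T) ^ (2 + i))))
      }
      where
      open Level (level i)
      lemma : ∀ α → suc (1 + 2 * α) ≡ 2 * suc α
      lemma = solve-∀
      lemma′ : ∀ T p → T * p + T * p ≡ 2 * T * p
      lemma′ = solve-∀

    padding : ∀ p → Input (suc k) p
    padding p = Vec.replicate p (true ∷ Vec.replicate _ false)

    val-padding : ∀ k p → suc (val (padding {k} p)) ≡ 2 ^ p
    val-padding k zero    = refl
    val-padding k (suc p) rewrite weight-false k | *-identityʳ (2 ^ p) | +-identityʳ (2 ^ p) =
      trans (sym (+-suc (2 ^ p) _)) (cong (2 ^ p +_) (val-padding k p))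

    -- A formula for `U` separates every pair, also after neutral padding to `N` columns. Fooling
    -- would then force `R` to be at most `α`, which is less than `2 ^ (2 + i)`.
    hard : ∀ i → 2 ^ (2 + i) ≤ R → ∀ {N} → (2 * T) ^ (2 + i) ≤ N →
      (f : Input (2 + i) N → Bool) → Thr (2 + i) f → ¬ (∀ x → f x ≡ (2 ^ N ≤ᵇ val x))
    hard i 2^k≤R {N} short≤N = subst
      (λ N → (f : Input (2 + i) N → Bool) → Thr (2 + i) f → ¬ (∀ x → f x ≡ (2 ^ N ≤ᵇ val x)))
      (m∸n+n≡m (≤-trans (n≤1+n length) (≤-trans short short≤N))) (hard-padded (N ∸ length))
      where
      open Level (level i)
      hard-padded : ∀ p (f : Input (2 + i) (p + length) → Bool) → Thr (2 + i) f →
        ¬ (∀ x → f x ≡ (2 ^ (p + length) ≤ᵇ val x))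
      hard-padded p f thr f≡U = <⇒≱ (*-monoˡ-< ∣ pairs ∣ {{>-nonZero nonempty}} (≤-trans (≤-reflexive α<2^k) 2^k≤R)) (begin
        R * ∣ pairs ∣
          ≡⟨ cong (R *_) (∑ᴸ-cong pairs fooled) ⟨
        R * ∑ᴸ pairs (λ q → viol (f (padding p Vec.++ q .accept)) (f (padding p Vec.++ q .reject)))
          ≤⟨ fooling (Thr-prefix (2 + i) (padding p) thr) ⟩
        α * ∣ pairs ∣   ∎)
        where
        open ≤-Reasoning
        fooled : ∀ q → viol (f (padding p Vec.++ q .accept)) (f (padding p Vec.++ q .reject)) ≡ 1
        fooled q rewrite f≡U (padding p Vec.++ q .accept) | f≡U (padding p Vec.++ q .reject) =
          separated (padded .val-accept) (padded .val-reject)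
          where
          padded = prepend (padding p) (val-padding (suc i) p) q

-- Unrolling circuits into formulas

empty? : ∀ n → n ≡ 0 ⊎ Fin n
empty? zero    = inj₁ refl
empty? (suc n) = inj₂ zero

evalAt : X → (X → Bool) → Bool
evalAt v x = x v

apply-input : ∀ m → m ≡ 0 → (lab : Label X m) (b : (X → Bool) → Fin m → Bool) →
  Literal evalAt (λ x → apply m lab x (b x))
apply-input zero refl (const b) _ = constant b λ _ → refl
apply-input zero refl (var v)   _ = coordinate v λ _ → refl

apply-gate : ∀ {B} ℓ m → Fin m → m ≤ B → (lab : Label X m) (g : Fin m → (X → Bool) → Bool) →
  (∀ i → Threshold B evalAt ℓ (g i)) → Threshold B evalAt (suc ℓ) (λ x → apply m lab x λ i → g i x)
apply-gate ℓ (suc m) _ m≤B (ℤ.+ t)    g thr = suc m , t , g , m≤B , thr , λ _ → refl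
-- A negative threshold is always met, just like 0.
apply-gate ℓ (suc m) _ m≤B -[1+ t ]   g thr = suc m , 0 , g , m≤B , thr , λ _ → refl

module Unrolling (C : Circuit X) {B : ℕ} (1≤B : 1 ≤ B) (size≤B : Circuit.size C ≤ B) where

  open Circuit C

  gatesOn-snoc : ∀ {i j l} (π : Star Wire i j) (w : Wire j l) →
    gatesOn (π ◅◅ (w ◅ ε)) ≡ gatesOn π + bit (isGate l)
  gatesOn-snoc ε           w = refl
  gatesOn-snoc {i} (v ◅ π) w =
    trans (cong (bit (isGate i) +_) (gatesOn-snoc π w)) (sym (+-assoc (bit (isGate i)) _ _))

  isGate-wire : ∀ {i} → Fin (indegree i) → bit (isGate i) ≡ 1
  isGate-wire {i} = lemma (indegree i)
    where
    lemma : ∀ m → Fin m → bit (1 ≤ᵇ m) ≡ 1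
    lemma (suc m) _ = refl

  gatesOn-wire : ∀ {i j} (p : Fin (indegree i)) (π : Star Wire j (source i p)) →
    gatesOn (π ◅◅ ((p , refl) ◅ ε)) ≡ suc (gatesOn π)
  gatesOn-wire {i} p π =
    trans (gatesOn-snoc π (p , refl)) (trans (cong (gatesOn π +_) (isGate-wire {i} p)) (+-comm (gatesOn π) 1))

  -- The depth condition speaks only of paths that start at input nodes, so refuting a gate at depth
  -- 0 takes such a path.
  source-input : ∀ i → Acc Wire i → ∃ λ j → IsInput j × Star Wire j i
  source-input i (acc rs) with empty? (indegree i)
  ... | inj₁ input = i , input , ε
  ... | inj₂ p = let j , input , π = source-input (source i p) (rs (p , refl)) in
    j , input , π ◅◅ ((p , refl) ◅ ε)

  -- Copying shared nodes may enlarge the formula, but every in-degree remains at most the size of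
  -- the circuit.
  unroll : ∀ ℓ i (a : Acc Wire i) → (∀ j → IsInput j → (π : Star Wire j i) → gatesOn π ≤ ℓ) →
    Threshold B evalAt ℓ (λ x → valueAcc x i a)
  unroll ℓ i (acc rs) depth with empty? (indegree i)
  ... | inj₁ input = Literal⇒Threshold 1≤B ℓ (apply-input (indegree i) input (label i) _)
  unroll zero i (acc rs) depth | inj₂ p with source-input (source i p) (rs (p , refl))
  ... | j , input , π =
    contradiction (subst (_≤ 0) (gatesOn-wire p π) (depth j input (π ◅◅ ((p , refl) ◅ ε)))) λ ()
  unroll (suc ℓ) i (acc rs) depth | inj₂ p =
    apply-gate ℓ (indegree i) p (≤-trans (≤-sum indegree i) size≤B) (label i) _ λ p →
      unroll ℓ (source i p) (rs (p , refl)) λ j input π →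
        s≤s⁻¹ (subst (_≤ suc ℓ) (gatesOn-wire p π) (depth j input (π ◅◅ ((p , refl) ◅ ε))))

  eval-threshold : ∀ {d} → Depth≤ d → Threshold B evalAt d eval
  eval-threshold {d} depth≤d = unroll d output (wire-wellFounded output) depth≤d

-- Choice of parameters and conclusion

-- The left side of the last inequality is the number `T` of blocks in `Levels` for in-degree bound
-- `2 ^ b` and `R` equal to `2 ^ d`.
size-exponent : ∀ d n s K → 2 * 2 ^ (d + 3) ≤ K → K ≤ n → ¬ (2 ^ n ≤ s ^ K) →
  Σ[ b ∈ ℕ ] s ≤ 2 ^ b × 2 * (2 ^ d * (2 * suc b)) ≤ n
size-exponent d n s K 2Q≤K K≤n small = b , s≤2^b , T≤n
  where
  open ≤-Reasoning
  Q b : ℕ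
  Q = 2 ^ (d + 3)
  instance
    Q-nonZero : NonZero Q
    Q-nonZero = m^n≢0 2 (d + 3)
  -- `Q` is 8 times `2 ^ d`: the two factors 2 in `T`, and one more from bounding `suc b` by
  -- `b + b`.
  b = n DivMod./ Q
  1≤b : 1 ≤ b
  1≤b = DivMod.m≥n⇒m/n>0 (≤-trans (m≤m+n Q _) (≤-trans 2Q≤K K≤n))
  n≤bK : n ≤ b * K
  n≤bK = begin
    n                         ≡⟨ DivMod.m≡m%n+[m/n]*n n Q ⟩
    n DivMod.% Q + b * Q      ≤⟨ +-monoˡ-≤ (b * Q) (<⇒≤ (DivMod.m%n<n n Q)) ⟩
    Q + b * Q                 ≤⟨ *-monoˡ-≤ Q (+-monoˡ-≤ b 1≤b) ⟩
    (b + b) * Q               ≡⟨ lemma b Q ⟩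
    b * (2 * Q)               ≤⟨ *-monoʳ-≤ b 2Q≤K ⟩
    b * K                     ∎
    where
    lemma : ∀ b q → (b + b) * q ≡ b * (2 * q)
    lemma = solve-∀
  s≤2^b : s ≤ 2 ^ b
  s≤2^b = ≮⇒≥ λ 2^b<s → small (begin
    2 ^ n          ≤⟨ ^-monoʳ-≤ 2 n≤bK ⟩
    2 ^ (b * K)    ≡⟨ ^-*-assoc 2 b K ⟨
    (2 ^ b) ^ K    ≤⟨ ^-monoˡ-≤ K (<⇒≤ 2^b<s) ⟩
    s ^ K          ∎)
  T≤n : 2 * (2 ^ d * (2 * suc b)) ≤ n
  T≤n = begin
    2 * (2 ^ d * (2 * suc b))        ≤⟨ *-monoʳ-≤ 2 (*-monoʳ-≤ (2 ^ d) (*-monoʳ-≤ 2 (+-monoˡ-≤ b 1≤b))) ⟩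
    2 * (2 ^ d * (2 * (b + b)))      ≡⟨ lemma (2 ^ d) b ⟩
    b * (2 ^ d * 8)                  ≡⟨ cong (b *_) (^-distribˡ-+-* 2 d 3) ⟨
    b * Q                            ≤⟨ DivMod.m/n*n≤m n Q ⟩
    n                                ∎
    where
    lemma : ∀ p b → 2 * (p * (2 * (b + b))) ≡ b * (p * 8)
    lemma = solve-∀

not-computed : ∀ d → 2 ≤ d → ∀ b {N} → (2 * (2 * (2 ^ d * (2 * suc b)))) ^ d ≤ N →
  (C : Circuit (Fin d × Fin N)) → Circuit.Depth≤ C d → Circuit.size C ≤ 2 ^ b → ¬ Computes C (U d N)
not-computed (suc (suc i)) (s≤s (s≤s z≤n)) b N≥ C depth size≤ computes =
  hard i ≤-refl N≥ (λ x → Circuit.eval C λ v → at v x) f-threshold (λ x → computes λ v → at v x)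
  where
  -- This `R` exceeds the error `α` of the level by exactly 1.
  open Fooling b (2 ^ (2 + i))
  open Levels (m^n>0 2 (2 + i))
  f-threshold : Thr (2 + i) (λ x → Circuit.eval C λ v → at v x)
  f-threshold = Threshold-∘ (λ x v → at v x) (λ v → coordinate v λ _ → refl) (2 + i)
    (Unrolling.eval-threshold C 1≤B size≤ depth)

theorem1 : (d n N : ℕ) → d ≥ 2 → n ≥ 1 → N ≥ 1 →
    n ≥ 2 ^ (60 * d) → N ≥ (2 ^ 13 * n) ^ d →
    (C : Circuit (Fin d × Fin N)) → Circuit.Depth≤ C d → Computes C (U d N) →
    Circuit.size C ≥2^ n / (2 ^ (60 * d))
theorem1 d n N d≥2 _ _ n≥ N≥ C depth computes =
  decidable-stable (2 ^ n ≤? Circuit.size C ^ (2 ^ (60 * d))) λ small →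
    let b , size≤ , T≤n = size-exponent d n (Circuit.size C) (2 ^ (60 * d)) (^-monoʳ-≤ 2 exponent) n≥ small in
    -- Here 2 + 8190 is `2 ^ 13`, so the length bound, the d-th power of twice the number of blocks,
    -- is at most `(2 ^ 13 * n) ^ d`.
    not-computed d d≥2 b (≤-trans (^-monoˡ-≤ d (*-mono-≤ (m≤m+n 2 8190) T≤n)) N≥) C depth size≤ computes
  where
  open ≤-Reasoning
  exponent : suc (d + 3) ≤ 60 * d
  exponent = begin
    suc (d + 3)    ≡⟨ cong suc (+-comm d 3) ⟩
    2 * 2 + d      ≤⟨ +-monoˡ-≤ d (*-monoʳ-≤ 2 d≥2) ⟩
    2 * d + d      ≡⟨ +-comm (2 * d) d ⟩
    3 * d          ≤⟨ *-monoˡ-≤ d (m≤m+n 3 57) ⟩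
    60 * d         ∎
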